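{- Let $\alpha$ be a composition of a non-negative integer $n$. Then \[\zeta_-(F_\alpha)=\frac{(-1)^{p_-(\alpha)}}{2^{2\lfloor n/2\rfloor}}\,C\bigl(p_-(\alpha),\lfloor n/2\rfloor-p_-(\alpha)\bigr),\] \[\zeta_+(F_\alpha)=\begin{cases}\dfrac{(-1)^{p_+(\alpha)}}{2^n}\,C\bigl(p_+(\alpha),n/2-p_+(\alpha)\bigr)&\text{if } n\text{ is even},\\ 0&\text{if } n\text{ is odd.}\end{cases}\]
   Context: $\Bbbk$ is a field of characteristic $\neq 2$. A composition $\alpha=(a_1,\ldots,a_k)$ of $n\ge0$ is a sequence of positive integers with sum $n$; $k(\alpha)=k$; $()$ is the empty composition. For compositions $\alpha,\beta$ of $n$, $\beta\ge\alpha$ means $\beta$ refines $\alpha$ ($\beta$ is obtained from $\alpha$ by splitting parts). Statistics: $p_-(\alpha)=\#\{i\ne k: a_i>1\}$; $p_+(\alpha)=1+\#\{i\ne 1,k: a_i>1\}$ if $k>1$, and $p_+(\alpha)=0$ if $k\le 1$. ${\mathcal{Q}Sym}$ is the Hopf algebra of quasi-symmetric functions over $\Bbbk$, graded and connected, with monomial basis $M_\alpha=\sum_{i_1<\cdots<i_k}x_{i_1}^{a_1}\cdots x_{i_k}^{a_k}$ ($M_{()}=1$), fundamental basis $F_\alpha=\sum_{\beta\ge\alpha}M_\beta$, ordinary product, coproduct $\Delta(M_\alpha)=\sum_{i=0}^kM_{(a_1,\ldots,a_i)}\otimes M_{(a_{i+1},\ldots,a_k)}$, counit $\epsilon(M_\alpha)=\delta_{\alpha,()}$.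 Convolution of functionals: $\rho\psi=m\circ(\rho\otimes\psi)\circ\Delta$. Characters (algebra morphisms ${\mathcal{Q}Sym}\to\Bbbk$) form a group under convolution. For a functional $\varphi$, $\bar\varphi(h)=(-1)^n\varphi(h)$ for $h$ homogeneous of degree $n$; $\varphi$ is even if $\bar\varphi=\varphi$ and odd if $\bar\varphi=\varphi^{ -1}$. Every character factors uniquely as $\varphi=\varphi_+\varphi_-$ with $\varphi_+$ even and $\varphi_-$ odd characters. The universal character is $\zeta(f)=f(1,0,0,\ldots)$, so $\zeta(M_\alpha)=\zeta(F_\alpha)=1$ if $\alpha=()$ or $\alpha=(n)$ and $0$ otherwise; $\zeta_\pm$ are its even and odd parts. $C(m,n)=\frac{(2m)!(2n)!}{m!(m+n)!n!}$. -}

module Defs where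

open import Level using (Level; _⊔_)
open import Algebra.Apartness.Bundles using (HeytingCommutativeRing; HeytingField)
open import Algebra.Bundles using (CommutativeRing; RawRing)
open import Algebra.Module.Bundles.Raw using (RawLeftModule)
import Algebra.Definitions.RawSemiring as RawSemiringDefs
import Algebra.Module.Construct.TensorUnit as TensorUnit
import Algebra.Module.Morphism.Structures as ModuleMorphisms
import Algebra.Morphism.Structures as Morphisms
import Algebra.Properties.Group as GroupProperties
import Algebra.Properties.Monoid.Sum as MonoidSum
open import Data.Bool.Base using (if_then_else_; true; false)
open import Data.Fin.Base using (toℕ)
open import Data.Fin.Properties using (toℕ≤pred[n])
open import Data.List.Base
  using (List; []; _∷_; _++_; map; concatMap; foldr; filter; length; take; drop; upTo)
open import Data.List.Properties using (≡-dec)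
open import Data.Nat.Base as ℕ using (ℕ; zero; suc; _!; pred; _<_; _≤_; _∸_)
open import Data.Nat.ListAction using (sum)
import Data.Nat.Properties as ℕₚ
open import Data.Product.Base using (_×_; _,_; proj₁; proj₂)
open import Relation.Binary.Definitions using (DecidableEquality)
open import Relation.Binary.PropositionalEquality as ≡ using (_≡_)
open import Relation.Nullary.Decidable.Core using (yes; no; does; map′)
open import Relation.Nullary.Negation.Core using (contradiction)

------------------------------------------------------------------------
-- Compositions

-- `1+ a` is the positive integer a + 1.
record ℕ⁺ : Set where
  constructor 1+_
  field
    predecessor : ℕ

  value : ℕ
  value = suc predecessor

open ℕ⁺ public using (value)

_≟⁺_ : DecidableEquality ℕ⁺
(1+ a) ≟⁺ (1+ b) = map′ (≡.cong 1+_) (λ { ≡.refl → ≡.refl }) (a ℕₚ.≟ b)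

Composition : Set
Composition = List ℕ⁺

_≟ᶜ_ : DecidableEquality Composition
_≟ᶜ_ = ≡-dec _≟⁺_

parts : Composition → List ℕ
parts = map value

size : Composition → ℕ
size α = sum (parts α)

-- Every composition of n + 1 arises exactly once from a composition of n,
-- by prepending a part 1 or by enlarging the first part by 1.
extend : Composition → List Composition
extend []           = ((1+ 0) ∷ []) ∷ []
extend ((1+ a) ∷ α) = ((1+ 0) ∷ (1+ a) ∷ α) ∷ ((1+ suc a) ∷ α) ∷ []

compositions : ℕ → List Composition
compositions zero    = [] ∷ []
compositions (suc n) = concatMap extend (compositions n)

-- All β ≥ α, each listed once: every part of α is split into a
-- composition of that part.
refinements : Composition → List Composition
refinements []      = [] ∷ []
refinements (a ∷ α) =
  concatMap (λ γ → map (γ ++_) (refinements α)) (compositions (value a))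

-- The pairs ((a₁,…,aᵢ) , (aᵢ₊₁,…,aₖ)) for 0 ≤ i ≤ k.
deconcatenations : Composition → List (Composition × Composition)
deconcatenations α = map (λ i → take i α , drop i α) (upTo (suc (length α)))

#parts>1 : Composition → ℕ
#parts>1 α = length (filter (1 ℕₚ.<?_) (parts α))

dropLast : Composition → Composition
dropLast α = take (pred (length α)) α

p₋ : Composition → ℕ
p₋ α = #parts>1 (dropLast α)

p₊ : Composition → ℕ
p₊ []              = 0
p₊ (_ ∷ [])        = 0
p₊ (_ ∷ α@(_ ∷ _)) = suc (#parts>1 (dropLast α))

-- The quotient is an integer for all m and n (a super Catalan number), so
-- the division in ℕ is exact.
C : ℕ → ℕ → ℕ
C m n = ((2 ℕ.* m) ! ℕ.* (2 ℕ.* n) !) ℕ./ (m ! ℕ.* (m ℕ.+ n) ! ℕ.* n !)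
  where
  instance
    _ = ℕₚ.m*n≢0 (m ! ℕ.* (m ℕ.+ n) !) (n !)
          {{ℕₚ.m*n≢0 (m !) ((m ℕ.+ n) !) {{m ℕₚ.!≢0}} {{(m ℕ.+ n) ℕₚ.!≢0}}}}
          {{n ℕₚ.!≢0}}

------------------------------------------------------------------------
-- Monomials in x₁, x₂, …

-- The list e₁ ∷ … ∷ eₘ ∷ [] stands for x₁^e₁ ⋯ xₘ^eₘ; lists that differ
-- only in trailing zeros stand for the same monomial.
Monomial : Set
Monomial = List ℕ

-- The nonzero exponents, in order.
flat : Monomial → Composition
flat []          = []
flat (zero  ∷ e) = flat e
flat (suc a ∷ e) = (1+ a) ∷ flat e

size-flat : ∀ e → size (flat e) ≡ sum e
size-flat []          = ≡.refl
size-flat (zero  ∷ e) = size-flat e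
size-flat (suc a ∷ e) = ≡.cong (suc a ℕ.+_) (size-flat e)

------------------------------------------------------------------------

module QuasiSymmetric {c ℓ₁ ℓ₂ : Level} (𝕜 : HeytingField c ℓ₁ ℓ₂) where

  open HeytingField 𝕜

  private
    𝕜-ring : CommutativeRing c ℓ₁
    𝕜-ring = HeytingCommutativeRing.commutativeRing heytingCommutativeRing

  open CommutativeRing 𝕜-ring public using (rawRing)
  open CommutativeRing 𝕜-ring using (+-monoid; +-group)
  open RawSemiringDefs (RawRing.rawSemiring rawRing) public
    using (_^_) renaming (sum to ∑; _×_ to _ℕ×_)
  open MonoidSum +-monoid using (sum-cong-≋; sum-replicate-zero)
  open GroupProperties +-group using (ε⁻¹≈ε)

  fromℕ : ℕ → Carrier
  fromℕ n = n ℕ× 1#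

  sgn : ℕ → Carrier
  sgn n = (- 1#) ^ n

  2# : Carrier
  2# = 1# + 1#

  -- The library supplies an inverse of 2# - 0#.
  ½ : 2# # 0# → Carrier
  ½ 2#0 = proj₁ (#⇒invertible 2#0)

  ----------------------------------------------------------------------
  -- Quasi-symmetric functions, as formal power series of bounded degree

  -- Lists with the same image under flat are either the same monomial or
  -- monomials x_{i₁}^a₁ ⋯ x_{iₖ}^aₖ and x_{j₁}^a₁ ⋯ x_{jₖ}^aₖ with
  -- i₁ < ⋯ < iₖ and j₁ < ⋯ < jₖ.
  Invariant : (Monomial → Carrier) → Set ℓ₁
  Invariant f = ∀ d e → flat d ≡ flat e → f d ≈ f e

  -- `bound` is any bound on the degree; it plays no role in equality.
  record QSym : Set (c ⊔ ℓ₁) where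
    field
      coeff     : Monomial → Carrier
      invariant : Invariant coeff
      bound     : ℕ
      bounded   : ∀ e → bound < sum e → coeff e ≈ 0#

  open QSym public

  infix  4 _≈ᑫ_
  infixl 6 _+ᑫ_
  infixl 7 _*ᑫ_
  infixr 7 _·_

  _≈ᑫ_ : QSym → QSym → Set ℓ₁
  f ≈ᑫ g = ∀ e → coeff f e ≈ coeff g e

  _+ᑫ_ : QSym → QSym → QSym
  f +ᑫ g = record
    { coeff     = λ e → coeff f e + coeff g e
    ; invariant = λ d e eq → +-cong (invariant f d e eq) (invariant g d e eq)
    ; bound     = bound f ℕ.⊔ bound g
    ; bounded   = λ e lt → trans
        (+-cong (bounded f e (ℕₚ.≤-<-trans (ℕₚ.m≤m⊔n _ _) lt))
                (bounded g e (ℕₚ.≤-<-trans (ℕₚ.m≤n⊔m (bound f) _) lt)))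
        (+-identityˡ 0#)
    }

  -ᑫ_ : QSym → QSym
  -ᑫ f = record
    { coeff     = λ e → - coeff f e
    ; invariant = λ d e eq → -‿cong (invariant f d e eq)
    ; bound     = bound f
    ; bounded   = λ e lt → trans (-‿cong (bounded f e lt)) ε⁻¹≈ε
    }

  0ᑫ : QSym
  0ᑫ = record
    { coeff     = λ _ → 0#
    ; invariant = λ _ _ _ → refl
    ; bound     = 0
    ; bounded   = λ _ _ → refl
    }

  _·_ : Carrier → QSym → QSym
  r · f = record
    { coeff     = λ e → r * coeff f e
    ; invariant = λ d e eq → *-congˡ (invariant f d e eq)
    ; bound     = bound f
    ; bounded   = λ e lt → trans (*-congˡ (bounded f e lt)) (zeroʳ r)
    }

  -- cauchy f g e is the sum of f d * g d′ over all factorisations of the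
  -- monomial e as d d′.
  cauchy : (f g : Monomial → Carrier) → Monomial → Carrier
  cauchy f g []      = f [] * g []
  cauchy f g (a ∷ e) =
    ∑ {suc a} λ i → cauchy (λ d → f (toℕ i ∷ d)) (λ d → g ((a ∸ toℕ i) ∷ d)) e

  private
    flat-∷ : ∀ a {d e} → flat d ≡ flat e → flat (a ∷ d) ≡ flat (a ∷ e)
    flat-∷ zero    eq = eq
    flat-∷ (suc a) eq = ≡.cong ((1+ a) ∷_) eq

    shift : ∀ {f} a → Invariant f → Invariant (λ d → f (a ∷ d))
    shift a inv d e eq = inv (a ∷ d) (a ∷ e) (flat-∷ a eq)

    cauchy-cong : ∀ {f f′ g g′} → (∀ d → f d ≈ f′ d) → (∀ d → g d ≈ g′ d) →
                  ∀ e → cauchy f g e ≈ cauchy f′ g′ e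
    cauchy-cong p q []      = *-cong (p []) (q [])
    cauchy-cong p q (a ∷ e) = sum-cong-≋ {suc a} λ i →
      cauchy-cong (λ d → p (toℕ i ∷ d)) (λ d → q ((a ∸ toℕ i) ∷ d)) e

    cauchy-0∷ : ∀ {f g} → Invariant f → Invariant g →
                ∀ e → cauchy f g (0 ∷ e) ≈ cauchy f g e
    cauchy-0∷ inv-f inv-g e = trans (+-identityʳ _)
      (cauchy-cong (λ d → inv-f (0 ∷ d) d ≡.refl) (λ d → inv-g (0 ∷ d) d ≡.refl) e)

    cauchy-flat : ∀ {f g} → Invariant f → Invariant g →
                  ∀ e → cauchy f g e ≈ cauchy f g (parts (flat e))
    cauchy-flat inv-f inv-g []          = refl
    cauchy-flat inv-f inv-g (zero ∷ e)  =
      trans (cauchy-0∷ inv-f inv-g e) (cauchy-flat inv-f inv-g e)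
    cauchy-flat inv-f inv-g (suc a ∷ e) = sum-cong-≋ {suc (suc a)} λ i →
      cauchy-flat (shift (toℕ i) inv-f) (shift (suc a ∸ toℕ i) inv-g) e

    cauchy-zero : ∀ {f g} e →
                  (∀ d d′ → sum d ℕ.+ sum d′ ≡ sum e → f d * g d′ ≈ 0#) →
                  cauchy f g e ≈ 0#
    cauchy-zero []      van = van [] [] ≡.refl
    cauchy-zero (a ∷ e) van = trans
      (sum-cong-≋ {suc a} λ i → cauchy-zero e λ d d′ eq →
        van (toℕ i ∷ d) ((a ∸ toℕ i) ∷ d′) (degree (toℕ i) (toℕ≤pred[n] i) d d′ eq))
      (sum-replicate-zero (suc a))
      where
      degree : ∀ i → i ≤ a → ∀ d d′ → sum d ℕ.+ sum d′ ≡ sum e →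
               (i ℕ.+ sum d) ℕ.+ ((a ∸ i) ℕ.+ sum d′) ≡ a ℕ.+ sum e
      degree i i≤a d d′ eq = ≡.trans
        (interchange i (sum d) (a ∸ i) (sum d′))
        (≡.cong₂ ℕ._+_ (ℕₚ.m+[n∸m]≡n i≤a) eq)
        where open import Algebra.Properties.CommutativeSemigroup ℕₚ.+-commutativeSemigroup

  _*ᑫ_ : QSym → QSym → QSym
  f *ᑫ g = record
    { coeff     = cauchy (coeff f) (coeff g)
    ; invariant = λ d e eq → trans
        (cauchy-flat (invariant f) (invariant g) d)
        (trans (reflexive (≡.cong (λ α → cauchy (coeff f) (coeff g) (parts α)) eq))
               (sym (cauchy-flat (invariant f) (invariant g) e)))
    ; bound     = bound f ℕ.+ bound g
    ; bounded   = λ e lt → cauchy-zero e λ d d′ eq →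
        vanish d d′ (≡.subst (bound f ℕ.+ bound g <_) (≡.sym eq) lt)
    }
    where
    vanish : ∀ d d′ → bound f ℕ.+ bound g < sum d ℕ.+ sum d′ →
             coeff f d * coeff g d′ ≈ 0#
    vanish d d′ lt with bound f ℕₚ.<? sum d
    ... | yes f<d = trans (*-congʳ (bounded f d f<d)) (zeroˡ _)
    ... | no  f≮d with bound g ℕₚ.<? sum d′
    ...   | yes g<d′ = trans (*-congˡ (bounded g d′ g<d′)) (zeroʳ _)
    ...   | no  g≮d′ = contradiction lt
              (ℕₚ.≤⇒≯ (ℕₚ.+-mono-≤ (ℕₚ.≮⇒≥ f≮d) (ℕₚ.≮⇒≥ g≮d′)))

  M : Composition → QSym
  M α = record
    { coeff     = λ e → if does (flat e ≟ᶜ α) then 1# else 0#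
    ; invariant = λ d e eq →
        reflexive (≡.cong (λ β → if does (β ≟ᶜ α) then 1# else 0#) eq)
    ; bound     = size α
    ; bounded   = vanish
    }
    where
    vanish : ∀ e → size α < sum e → (if does (flat e ≟ᶜ α) then 1# else 0#) ≈ 0#
    vanish e lt with flat e ≟ᶜ α
    ... | yes ≡.refl = contradiction (size-flat e) (ℕₚ.<⇒≢ lt)
    ... | no  _      = refl

  1ᑫ : QSym
  1ᑫ = M []

  F : Composition → QSym
  F α = foldr (λ β f → M β +ᑫ f) 0ᑫ (refinements α)

  QSym-rawRing : RawRing (c ⊔ ℓ₁) ℓ₁
  QSym-rawRing = record
    { Carrier = QSym
    ; _≈_     = _≈ᑫ_
    ; _+_     = _+ᑫ_
    ; _*_     = _*ᑫ_
    ; -_      = -ᑫ_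
    ; 0#      = 0ᑫ
    ; 1#      = 1ᑫ
    }

  QSym-rawLeftModule : RawLeftModule Carrier (c ⊔ ℓ₁) ℓ₁
  QSym-rawLeftModule = record
    { Carrierᴹ = QSym
    ; _≈ᴹ_     = _≈ᑫ_
    ; _+ᴹ_     = _+ᑫ_
    ; _*ₗ_     = _·_
    ; 0ᴹ       = 0ᑫ
    ; -ᴹ_      = -ᑫ_
    }

  -- An element of QSym ⊗ QSym is represented by a list of pure tensors,
  -- standing for their sum.
  Tensors : Set (c ⊔ ℓ₁)
  Tensors = List (QSym × QSym)

  -- Linear extension of Δ(M_α), using f = ∑ f_α M_α, where f_α is the
  -- coefficient of x₁^a₁ ⋯ xₖ^aₖ in f.
  Δ : QSym → Tensors
  Δ f =
    concatMap (λ n →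
      concatMap (λ α →
        map (λ (β , γ) → coeff f (parts α) · M β , M γ) (deconcatenations α))
      (compositions n))
    (upTo (suc (bound f)))

  component : ℕ → QSym → QSym
  component n f = record
    { coeff     = λ e → if does (sum e ℕₚ.≟ n) then coeff f e else 0#
    ; invariant = inv
    ; bound     = bound f
    ; bounded   = vanish
    }
    where
    inv : Invariant (λ e → if does (sum e ℕₚ.≟ n) then coeff f e else 0#)
    inv d e eq
      rewrite ≡.trans (≡.sym (size-flat d)) (≡.trans (≡.cong size eq) (size-flat e))
      with does (sum e ℕₚ.≟ n)
    ... | true  = invariant f d e eq
    ... | false = refl

    vanish : ∀ e → bound f < sum e →
             (if does (sum e ℕₚ.≟ n) then coeff f e else 0#) ≈ 0#
    vanish e lt with does (sum e ℕₚ.≟ n)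
    ... | true  = bounded f e lt
    ... | false = refl

  ----------------------------------------------------------------------
  -- Functionals and characters

  Functional : Set (c ⊔ ℓ₁)
  Functional = QSym → Carrier

  infix  4 _≋_
  infixl 7 _⋆_

  _≋_ : Functional → Functional → Set (c ⊔ ℓ₁)
  φ ≋ ψ = ∀ f → φ f ≈ ψ f

  record IsCharacter (φ : Functional) : Set (c ⊔ ℓ₁) where
    open ModuleMorphisms.LeftModuleMorphisms
      QSym-rawLeftModule (TensorUnit.rawLeftModule {R = rawRing})
    open Morphisms.RingMorphisms QSym-rawRing rawRing
    field
      isLeftModuleHomomorphism : IsLeftModuleHomomorphism φ
      isRingHomomorphism       : IsRingHomomorphism φ

  m∘⟨_⊗_⟩ : Functional → Functional → Tensors → Carrier
  m∘⟨ ρ ⊗ ψ ⟩ = foldr (λ (g , h) s → ρ g * ψ h + s) 0#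

  _⋆_ : Functional → Functional → Functional
  (ρ ⋆ ψ) f = m∘⟨ ρ ⊗ ψ ⟩ (Δ f)

  -- The counit is the constant coefficient.
  ε : Functional
  ε f = coeff f []

  bar : Functional → Functional
  bar φ f = ∑ {suc (bound f)} λ n → sgn (toℕ n) * φ (component (toℕ n) f)

  IsEven : Functional → Set (c ⊔ ℓ₁)
  IsEven φ = bar φ ≋ φ

  -- bar φ is the convolution inverse of φ.
  IsOdd : Functional → Set (c ⊔ ℓ₁)
  IsOdd φ = (bar φ ⋆ φ ≋ ε) × (φ ⋆ bar φ ≋ ε)

  -- f(1,0,0,…): the monomials x₁^i evaluate to 1 and all others to 0.
  ζ : Functional
  ζ f = ∑ {suc (bound f)} λ i → coeff f (toℕ i ∷ [])

  -- φ = φ₊ φ₋ is the factorisation of φ into its even and odd parts.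
  record IsParityFactorisation (φ φ₊ φ₋ : Functional) : Set (c ⊔ ℓ₁) where
    field
      isCharacter₊  : IsCharacter φ₊
      isCharacter₋  : IsCharacter φ₋
      even          : IsEven φ₊
      odd           : IsOdd φ₋
      factorisation : φ ≋ φ₊ ⋆ φ₋

{-# OPTIONS --safe #-}

-- On the monomial basis a functional is a function on compositions, and the
-- convolution product cuts compositions in two.  Twisting ζ = ζ₊ ζ₋ by
-- (−1)^degree gives ζ₊ = ζ̄ ζ₋, so ζ = ζ̄ ζ₋ ζ₋, and since 2 is invertible this
-- determines ζ₋.  With u_j = C(0,j)/4^j the solution is
--   ζ₋(M_α) = (−1)^{#even parts} u_{⌊#odd parts / 2⌋} if the last part is odd,
-- and 0 if it is even; this rests on (∑ u_{⌊k/2⌋} t^k)² = (1 + t)/(1 − t).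
-- Let L be the linear form t^k ↦ u_{⌊k/2⌋}.  Summing over the refinements of α,
-- every part a > 1 other than the last contributes a factor t^a − t^{a−2} and
-- every other part a factor t^a, whence ζ₋(F_α) = L(t^{n−2p}(t² − 1)^p) with
-- p = p₋(α); likewise ζ₊(F_α) = L(t^{n−2p}(t² − 1)^p) with p = p₊(α) for even n.
-- These are evaluated by C(m+1,n) + C(m,n+1) = 4 C(m,n).
module Submission where

open import Defs
open import Algebra.Apartness.Bundles using (HeytingCommutativeRing; HeytingField)
open import Algebra.Bundles using (CommutativeRing; CommutativeSemiring)
import Algebra.Module.Construct.TensorUnit as TensorUnit
import Algebra.Module.Morphism.Structures as ModuleMorphisms
import Algebra.Morphism.Structures as Morphisms
import Algebra.Properties.AbelianGroup as AbelianGroupProperties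
import Algebra.Properties.CommutativeSemigroup as CommutativeSemigroupProperties
import Algebra.Properties.Group as GroupProperties
import Algebra.Properties.Ring as RingProperties
import Algebra.Properties.Semiring.Exp as Exp
import Algebra.Properties.Semiring.Mult as Mult
open import Data.Bool.Base using (Bool; true; false; if_then_else_)
import Data.Bool.Properties as 𝔹
open import Data.Fin.Base using (toℕ)
open import Data.List.Base
  using (List; []; _∷_; _++_; map; concatMap; foldr; length; take; drop; upTo; applyUpTo)
open import Data.Nat.Base as ℕ using (ℕ; zero; suc; _!; _∸_; ⌊_/2⌋) renaming (_*_ to _ℕ*_)
open import Data.Nat.Combinatorics.Specification using ([n∸k]!k!∣n!)
open import Data.Nat.DivMod using (m/n*n≡m)
open import Data.Nat.Divisibility using (_∣_; _∤_; divides; ∣m∣n⇒∣m+n; ∣-refl; _∣0)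
open import Data.Nat.ListAction using (sum)
import Data.Nat.Properties as ℕₚ
open import Data.Nat.Tactic.RingSolver using (solve-∀)
open import Data.Product.Base using (_×_; _,_; proj₁; proj₂; ∃-syntax)
open import Function.Base using (_∘_; id)
open import Relation.Binary.PropositionalEquality as ≡ using (_≡_)
import Relation.Binary.Reasoning.Setoid as SetoidReasoning
open import Relation.Nullary.Decidable using (Dec; yes; no; does; dec-true; dec-false)
open import Relation.Nullary.Negation.Core using (contradiction; ¬_)

-- Super Catalan numbers

-- The formula for ζ₋ comes from looking for the square root among functionals that see only the
-- parities of the parts, with an unknown sequence U_k in place of u_⌊k/2⌋. In a product of two of
-- them a cut contributes 0 unless its left piece is empty or ends in an odd part. If a composition
-- has k odd parts and ends in one, its surviving cuts distribute them as i + (k - i), once for each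
-- i. So these functionals multiply as the power series ∑ U_k t^k do, and the problem becomes a
-- square root of 1 + 2t + 2t² + .... That root is (1 + t)(1 - t²)^(-1/2), and the binomial series
-- produces C(0,j)/4^j. A square root with value 1 on the empty composition is unique, so it is
-- enough to verify the candidate, and no convolution inverse is ever computed. The factors t^a -
-- t^(a-2) arise because parts enter the weight only through their parity, so that nearly all
-- refinements of a part cancel.

module SuperCatalan where

  open import Data.Nat.Base using (_+_; _*_; _^_; NonZero)
  open ≡.≡-Reasoning

  C-numerator C-denominator : ℕ → ℕ → ℕ
  C-numerator   m n = (2 * m) ! * (2 * n) !
  C-denominator m n = m ! * (m + n) ! * n !

  C-denominator≢0 : ∀ m n → NonZero (C-denominator m n)
  C-denominator≢0 m n = ℕₚ.m*n≢0 (m ! * (m + n) !) (n !)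
    {{ℕₚ.m*n≢0 (m !) ((m + n) !) {{m ℕₚ.!≢0}} {{(m + n) ℕₚ.!≢0}}}} {{n ℕₚ.!≢0}}

  [2+2m]! : ∀ m → (2 * suc m) ! ≡ 2 * suc m * ((2 * m + 1) * (2 * m) !)
  [2+2m]! m = begin
    (2 * suc m) !                                ≡⟨ ≡.cong _! (ℕₚ.*-suc 2 m) ⟩
    (2 + 2 * m) * ((1 + 2 * m) * (2 * m) !)
      ≡⟨ ≡.cong₂ (λ a b → a * (b * (2 * m) !)) (≡.sym (ℕₚ.*-suc 2 m)) (ℕₚ.+-comm 1 (2 * m)) ⟩
    2 * suc m * ((2 * m + 1) * (2 * m) !)        ∎

  C-numerator-sucˡ : ∀ m n → C-numerator (suc m) n ≡ 2 * suc m * (2 * m + 1) * C-numerator m n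
  C-numerator-sucˡ m n = ≡.trans (≡.cong (_* (2 * n) !) ([2+2m]! m))
    (assoc (2 * suc m) (2 * m + 1) ((2 * m) !) ((2 * n) !))
    where
    assoc : ∀ a b c d → a * (b * c) * d ≡ a * b * (c * d)
    assoc = solve-∀

  C-numerator-sucʳ : ∀ m n → C-numerator m (suc n) ≡ 2 * suc n * (2 * n + 1) * C-numerator m n
  C-numerator-sucʳ m n = ≡.trans (≡.cong ((2 * m) ! *_) ([2+2m]! n))
    (assoc (2 * suc n) (2 * n + 1) ((2 * m) !) ((2 * n) !))
    where
    assoc : ∀ a b c d → c * (a * (b * d)) ≡ a * b * (c * d)
    assoc = solve-∀

  C-denominator-sucˡ : ∀ m n → C-denominator (suc m) n ≡ suc m * suc (m + n) * C-denominator m n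
  C-denominator-sucˡ m n = assoc (suc m) (suc (m + n)) (m !) ((m + n) !) (n !)
    where
    assoc : ∀ a b c d e → a * c * (b * d) * e ≡ a * b * (c * d * e)
    assoc = solve-∀

  C-denominator-sucʳ : ∀ m n → C-denominator m (suc n) ≡ suc n * suc (m + n) * C-denominator m n
  C-denominator-sucʳ m n = ≡.trans
    (≡.cong (λ k → m ! * k ! * suc n !) (ℕₚ.+-suc m n))
    (assoc (suc n) (suc (m + n)) (m !) ((m + n) !) (n !))
    where
    assoc : ∀ a b c d e → c * (b * d) * (a * e) ≡ a * b * (c * d * e)
    assoc = solve-∀

  -- The quotients `c` and `c′` are arbitrary rather than values of `C`, because this recurrence is
  -- already used inside the proof that the division defining `C` is exact.
  exact-sucʳ : ∀ m n {c c′} →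
    c * C-denominator m n ≡ C-numerator m n →
    c′ * C-denominator m (suc n) ≡ C-numerator m (suc n) →
    suc (m + n) * c′ ≡ 2 * (2 * n + 1) * c
  exact-sucʳ m n {c} {c′} eq eq′ =
    ℕₚ.*-cancelʳ-≡ _ _ (suc n * C-denominator m n)
      {{ℕₚ.m*n≢0 (suc n) (C-denominator m n) {{_}} {{C-denominator≢0 m n}}}} (begin
    suc (m + n) * c′ * (suc n * D)       ≡⟨ assoc (suc (m + n)) c′ (suc n) D ⟩
    c′ * (suc n * suc (m + n) * D)       ≡⟨ ≡.cong (c′ *_) (C-denominator-sucʳ m n) ⟨
    c′ * C-denominator m (suc n)         ≡⟨ eq′ ⟩
    C-numerator m (suc n)                ≡⟨ C-numerator-sucʳ m n ⟩
    2 * suc n * (2 * n + 1) * C-numerator m n ≡⟨ ≡.cong (2 * suc n * (2 * n + 1) *_) eq ⟨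
    2 * suc n * (2 * n + 1) * (c * D)    ≡⟨ assoc′ (suc n) (2 * n + 1) c D ⟩
    2 * (2 * n + 1) * c * (suc n * D)    ∎)
    where
    D = C-denominator m n
    assoc : ∀ a b c d → a * b * (c * d) ≡ b * (c * a * d)
    assoc = solve-∀
    assoc′ : ∀ a b c d → 2 * a * b * (c * d) ≡ 2 * b * c * (a * d)
    assoc′ = solve-∀

  -- Integrality by induction on m, from C(m+1,n) = 4 C(m,n) − C(m,n+1).
  C-denominator∣C-numerator : ∀ m n → C-denominator m n ∣ C-numerator m n
  -- For `m = 0` the quotient is the central binomial coefficient.
  C-denominator∣C-numerator zero n = ≡.subst₂ _∣_ lhs rhs ([n∸k]!k!∣n! (ℕₚ.m≤m+n n (n + 0)))
    where
    lhs : (2 * n ∸ n) ! * n ! ≡ C-denominator 0 n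
    lhs = ≡.cong (_* n !) (begin
      (2 * n ∸ n) ! ≡⟨ ≡.cong _! (≡.trans (ℕₚ.m+n∸m≡n n (n + 0)) (ℕₚ.+-identityʳ n)) ⟩
      n !           ≡⟨ ℕₚ.*-identityˡ (n !) ⟨
      1 * n !       ∎)
    rhs : (2 * n) ! ≡ C-numerator 0 n
    rhs = ≡.sym (ℕₚ.*-identityˡ _)
  C-denominator∣C-numerator (suc m) n
    with C-denominator∣C-numerator m n | C-denominator∣C-numerator m (suc n)
  ... | divides c eq | divides c′ eq′ = divides (4 * c ∸ c′) (≡.sym (begin
    (4 * c ∸ c′) * C-denominator (suc m) n
      ≡⟨ ≡.cong ((4 * c ∸ c′) *_) (C-denominator-sucˡ m n) ⟩
    (4 * c ∸ c′) * (suc m * s * D)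
      ≡⟨ assoc (4 * c ∸ c′) (suc m) s D ⟩
    s * (4 * c ∸ c′) * (suc m * D)
      ≡⟨ ≡.cong (_* (suc m * D)) scaled ⟩
    2 * (2 * m + 1) * c * (suc m * D)
      ≡⟨ assoc′ (2 * m + 1) c (suc m) D ⟩
    2 * suc m * (2 * m + 1) * (c * D)
      ≡⟨ ≡.cong (2 * suc m * (2 * m + 1) *_) eq ⟨
    2 * suc m * (2 * m + 1) * C-numerator m n
      ≡⟨ C-numerator-sucˡ m n ⟨
    C-numerator (suc m) n ∎))
    where
    D = C-denominator m n
    s = suc (m + n)
    assoc : ∀ a b c d → a * (b * c * d) ≡ c * a * (b * d)
    assoc = solve-∀
    assoc′ : ∀ a b c d → 2 * a * b * (c * d) ≡ 2 * c * a * (b * d)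
    assoc′ = solve-∀
    split : ∀ m n c → suc (m + n) * (4 * c) ≡ 2 * (2 * m + 1) * c + 2 * (2 * n + 1) * c
    split = solve-∀
    scaled : s * (4 * c ∸ c′) ≡ 2 * (2 * m + 1) * c
    scaled = begin
      s * (4 * c ∸ c′)       ≡⟨ ℕₚ.*-distribˡ-∸ s (4 * c) c′ ⟩
      s * (4 * c) ∸ s * c′   ≡⟨ ≡.cong₂ _∸_ (split m n c) (exact-sucʳ m n {c} {c′} (≡.sym eq) (≡.sym eq′)) ⟩
      2 * (2 * m + 1) * c + 2 * (2 * n + 1) * c ∸ 2 * (2 * n + 1) * c
                             ≡⟨ ℕₚ.m+n∸n≡m _ (2 * (2 * n + 1) * c) ⟩
      2 * (2 * m + 1) * c    ∎

  C-exact : ∀ m n → C m n * C-denominator m n ≡ C-numerator m n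
  C-exact m n = m/n*n≡m (C-denominator∣C-numerator m n)
    where instance _ = C-denominator≢0 m n

  C-sucʳ : ∀ m n → suc (m + n) * C m (suc n) ≡ 2 * (2 * n + 1) * C m n
  C-sucʳ m n = exact-sucʳ m n {C m n} {C m (suc n)} (C-exact m n) (C-exact m (suc n))

  C-sucˡ : ∀ m n → suc (m + n) * C (suc m) n ≡ 2 * (2 * m + 1) * C m n
  C-sucˡ m n =
    ℕₚ.*-cancelʳ-≡ _ _ (suc m * D)
      {{ℕₚ.m*n≢0 (suc m) D {{_}} {{C-denominator≢0 m n}}}} (begin
    suc (m + n) * C (suc m) n * (suc m * D)   ≡⟨ assoc (suc (m + n)) (C (suc m) n) (suc m) D ⟩
    C (suc m) n * (suc m * suc (m + n) * D)   ≡⟨ ≡.cong (C (suc m) n *_) (C-denominator-sucˡ m n) ⟨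
    C (suc m) n * C-denominator (suc m) n     ≡⟨ C-exact (suc m) n ⟩
    C-numerator (suc m) n                     ≡⟨ C-numerator-sucˡ m n ⟩
    2 * suc m * (2 * m + 1) * C-numerator m n ≡⟨ ≡.cong (2 * suc m * (2 * m + 1) *_) (C-exact m n) ⟨
    2 * suc m * (2 * m + 1) * (C m n * D)     ≡⟨ assoc′ (suc m) (2 * m + 1) (C m n) D ⟩
    2 * (2 * m + 1) * C m n * (suc m * D)     ∎)
    where
    D = C-denominator m n
    assoc : ∀ a b c d → a * b * (c * d) ≡ b * (c * a * d)
    assoc = solve-∀
    assoc′ : ∀ a b c d → 2 * a * b * (c * d) ≡ 2 * b * c * (a * d)
    assoc′ = solve-∀

  -- Multiplied by m + n + 1, each term becomes a multiple of `C m n`, and (4m + 2) + (4n + 2) = 4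
  -- (m + n + 1).
  C-pascal : ∀ m n → C (suc m) n + C m (suc n) ≡ 4 * C m n
  C-pascal m n = ℕₚ.*-cancelˡ-≡ _ _ (suc (m + n)) (begin
    suc (m + n) * (C (suc m) n + C m (suc n))
      ≡⟨ ℕₚ.*-distribˡ-+ (suc (m + n)) (C (suc m) n) (C m (suc n)) ⟩
    suc (m + n) * C (suc m) n + suc (m + n) * C m (suc n)
      ≡⟨ ≡.cong₂ _+_ (C-sucˡ m n) (C-sucʳ m n) ⟩
    2 * (2 * m + 1) * C m n + 2 * (2 * n + 1) * C m n
      ≡⟨ merge m n (C m n) ⟩
    suc (m + n) * (4 * C m n) ∎)
    where
    merge : ∀ m n c → 2 * (2 * m + 1) * c + 2 * (2 * n + 1) * c ≡ suc (m + n) * (4 * c)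
    merge = solve-∀

-- Cauchy products of sequences

module Convolution {c ℓ} (R : CommutativeSemiring c ℓ) where

  open CommutativeSemiring R
  open CommutativeSemigroupProperties +-commutativeSemigroup using (interchange; x∙yz≈y∙xz)
  open SetoidReasoning setoid

  -- Defined over any commutative semiring: the central binomial identity is proved over ℕ and then
  -- carried to the field, where the powers of 1/4 enter.
  conv : (u v : ℕ → Carrier) → ℕ → Carrier
  conv u v zero    = u 0 * v 0
  conv u v (suc m) = u 0 * v (suc m) + conv (u ∘ suc) v m

  conv-cong : ∀ {u u′ v v′} → (∀ j → u j ≈ u′ j) → (∀ j → v j ≈ v′ j) →
              ∀ m → conv u v m ≈ conv u′ v′ m
  conv-cong p q zero    = *-cong (p 0) (q 0)
  conv-cong p q (suc m) = +-cong (*-cong (p 0) (q (suc m))) (conv-cong (p ∘ suc) q m)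

  conv-last : ∀ u v m → conv u v (suc m) ≈ conv u (v ∘ suc) m + u (suc m) * v 0
  conv-last u v zero    = refl
  conv-last u v (suc m) = trans (+-congˡ (conv-last (u ∘ suc) v m)) (sym (+-assoc _ _ _))

  conv-comm : ∀ u v m → conv u v m ≈ conv v u m
  conv-comm u v zero    = *-comm _ _
  conv-comm u v (suc m) = begin
    u 0 * v (suc m) + conv (u ∘ suc) v m ≈⟨ +-comm _ _ ⟩
    conv (u ∘ suc) v m + u 0 * v (suc m) ≈⟨ +-cong (conv-comm (u ∘ suc) v m) (*-comm _ _) ⟩
    conv v (u ∘ suc) m + v (suc m) * u 0 ≈⟨ conv-last v u m ⟨
    conv v u (suc m)                     ∎

  conv-distribʳ-+ : ∀ u u′ v m → conv (λ j → u j + u′ j) v m ≈ conv u v m + conv u′ v m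
  conv-distribʳ-+ u u′ v zero    = distribʳ _ _ _
  conv-distribʳ-+ u u′ v (suc m) = trans
    (+-cong (distribʳ _ _ _) (conv-distribʳ-+ (u ∘ suc) (u′ ∘ suc) v m))
    (interchange _ _ _ _)

  conv-*-assoc : ∀ x u v m → conv (λ j → x * u j) v m ≈ x * conv u v m
  conv-*-assoc x u v zero    = *-assoc _ _ _
  conv-*-assoc x u v (suc m) = trans
    (+-cong (*-assoc _ _ _) (conv-*-assoc x (u ∘ suc) v m))
    (sym (distribˡ _ _ _))

  -- With generating functions u(t), the sequence j ↦ u ⌊ j /2⌋ has
  -- generating function (1 + t) u(t²).
  conv-halves : ∀ u v k →
    conv (λ j → u ℕ.⌊ j /2⌋) (λ j → v ℕ.⌊ j /2⌋) (suc k) ≈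
    conv u v ℕ.⌊ suc k /2⌋ + conv u v ℕ.⌊ k /2⌋
  conv-halves u v zero          = refl
  conv-halves u v (suc zero)    = trans (x∙yz≈y∙xz _ _ _) (+-comm _ _)
  conv-halves u v (suc (suc k)) = begin
    a + (b + conv (λ j → u (suc ℕ.⌊ j /2⌋)) (λ j → v ℕ.⌊ j /2⌋) (suc k))
      ≈⟨ +-congˡ (+-congˡ (conv-halves (u ∘ suc) v k)) ⟩
    a + (b + (conv (u ∘ suc) v ℕ.⌊ suc k /2⌋ + conv (u ∘ suc) v ℕ.⌊ k /2⌋))
      ≈⟨ +-assoc _ _ _ ⟨
    a + b + (conv (u ∘ suc) v ℕ.⌊ suc k /2⌋ + conv (u ∘ suc) v ℕ.⌊ k /2⌋)
      ≈⟨ interchange _ _ _ _ ⟩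
    conv u v (suc ℕ.⌊ suc k /2⌋) + conv u v (suc ℕ.⌊ k /2⌋) ∎
    where
    a = u 0 * v (suc ℕ.⌊ suc k /2⌋)
    b = u 0 * v (suc ℕ.⌊ k /2⌋)

-- The self-convolution of the central binomial coefficients

module CentralBinomial where

  open import Data.Nat.Base using (_+_; _*_; _^_)
  open Convolution ℕₚ.+-*-commutativeSemiring
  open SuperCatalan using (C-sucʳ)
  open ≡.≡-Reasoning

  -- The Leibniz rule for t d/dt, with an offset `a`: each recursive step replaces `u` by `u ∘ suc`,
  -- whose weights are larger by one.
  conv-leibniz : ∀ a u v m →
    (a + m) * conv u v m ≡ conv (λ j → (a + j) * u j) v m + conv u (λ j → j * v j) m
  conv-leibniz a u v zero    = base (a + 0) (u 0) (v 0)
    where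
    base : ∀ a x y → a * (x * y) ≡ a * x * y + x * 0
    base = solve-∀
  conv-leibniz a u v (suc m) = begin
    (a + suc m) * (x * y + conv (u ∘ suc) v m)
      ≡⟨ ℕₚ.*-distribˡ-+ (a + suc m) (x * y) _ ⟩
    (a + suc m) * (x * y) + (a + suc m) * conv (u ∘ suc) v m
      ≡⟨ ≡.cong (λ b → (a + suc m) * (x * y) + b * conv (u ∘ suc) v m) (ℕₚ.+-suc a m) ⟩
    (a + suc m) * (x * y) + (suc a + m) * conv (u ∘ suc) v m
      ≡⟨ ≡.cong ((a + suc m) * (x * y) +_) (conv-leibniz (suc a) (u ∘ suc) v m) ⟩
    (a + suc m) * (x * y) + (conv (λ j → (suc a + j) * u (suc j)) v m + s)
      ≡⟨ ≡.cong (λ t → (a + suc m) * (x * y) + (t + s))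
           (conv-cong (λ j → ≡.cong (_* u (suc j)) (≡.sym (ℕₚ.+-suc a j))) (λ _ → ≡.refl) m) ⟩
    (a + suc m) * (x * y) + (conv (λ j → (a + suc j) * u (suc j)) v m + s)
      ≡⟨ regroup a (suc m) x y _ s ⟩
    ((a * x) * y + conv (λ j → (a + suc j) * u (suc j)) v m) + (x * (suc m * y) + s)
      ≡⟨ ≡.cong (λ b → ((b * x) * y + conv (λ j → (a + suc j) * u (suc j)) v m) + (x * (suc m * y) + s))
           (ℕₚ.+-identityʳ a) ⟨
    conv (λ j → (a + j) * u j) v (suc m) + conv u (λ j → j * v j) (suc m) ∎
    where
    x = u 0
    y = v (suc m)
    s = conv (u ∘ suc) (λ j → j * v j) m
    regroup : ∀ a k x y t s → (a + k) * (x * y) + (t + s) ≡ (a * x * y + t) + (x * (k * y) + s)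
    regroup = solve-∀

  -- The recurrence (j+1) c_{j+1} = (4j+2) c_j and the Leibniz rule for the
  -- weight j give (m+1) s_{m+1} = 4 (m+1) s_m for s = conv c c.
  conv-C : ∀ m → conv (C 0) (C 0) m ≡ 4 ^ m
  conv-C zero    = ≡.refl
  conv-C (suc m) = ≡.trans (ℕₚ.*-cancelˡ-≡ _ _ (suc m) (begin
    suc m * conv c c (suc m)
      ≡⟨ weighted (suc m) ⟩
    2 * conv d c (suc m)
      ≡⟨ ≡.cong (2 *_) (conv-cong d-suc (λ _ → ≡.refl) m) ⟩
    2 * conv (λ j → 4 * d j + 2 * c j) c m
      ≡⟨ ≡.cong (2 *_) (conv-distribʳ-+ (λ j → 4 * d j) (λ j → 2 * c j) c m) ⟩
    2 * (conv (λ j → 4 * d j) c m + conv (λ j → 2 * c j) c m)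
      ≡⟨ ≡.cong (2 *_) (≡.cong₂ _+_ (conv-*-assoc 4 d c m) (conv-*-assoc 2 c c m)) ⟩
    2 * (4 * conv d c m + 2 * conv c c m)
      ≡⟨ regroup (conv d c m) (conv c c m) ⟩
    4 * (2 * conv d c m) + 4 * conv c c m
      ≡⟨ ≡.cong (λ t → 4 * t + 4 * conv c c m) (weighted m) ⟨
    4 * (m * conv c c m) + 4 * conv c c m
      ≡⟨ collect m (conv c c m) ⟩
    suc m * (4 * conv c c m) ∎)) (≡.cong (4 *_) (conv-C m))
    where
    c d : ℕ → ℕ
    c   = C 0
    d j = j * c j
    d-suc : ∀ j → d (suc j) ≡ 4 * d j + 2 * c j
    d-suc j = ≡.trans (C-sucʳ 0 j) (expand j (c j))
      where
      expand : ∀ j x → 2 * (2 * j + 1) * x ≡ 4 * (j * x) + 2 * x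
      expand = solve-∀
    weighted : ∀ m → m * conv c c m ≡ 2 * conv d c m
    weighted m = begin
      m * conv c c m              ≡⟨ conv-leibniz 0 c c m ⟩
      conv d c m + conv c d m     ≡⟨ ≡.cong (conv d c m +_) (conv-comm c d m) ⟩
      conv d c m + conv d c m     ≡⟨ ≡.cong (conv d c m +_) (ℕₚ.+-identityʳ _) ⟨
      2 * conv d c m              ∎
    regroup : ∀ x y → 2 * (4 * x + 2 * y) ≡ 4 * (2 * x) + 4 * y
    regroup = solve-∀
    collect : ∀ m y → 4 * (m * y) + 4 * y ≡ suc m * (4 * y)
    collect = solve-∀

-- Functionals as functions on compositions

isEven : ℕ → Bool
isEven zero          = true
isEven (suc zero)    = false
isEven (suc (suc n)) = isEven n

-- The part `1+ a` stores its value minus one, which reverses the parity.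
hasOddValue : ℕ⁺ → Bool
hasOddValue (1+ a) = isEven a

isEven-pred : ∀ n → isEven (suc n) ≡ false → isEven n ≡ true
isEven-pred zero          eq = ≡.refl
isEven-pred (suc (suc n)) eq = isEven-pred n eq

module Deconcatenation {c ℓ} (R : CommutativeRing c ℓ) where

  open CommutativeRing R
  open RingProperties ring using (-1*x≈-x; +-cancelʳ; +-cancelˡ)
  open CommutativeSemigroupProperties +-commutativeSemigroup using (interchange; x∙yz≈y∙xz)
  open CommutativeSemigroupProperties *-commutativeSemigroup
    using () renaming (interchange to *-interchange; x∙yz≈y∙xz to x*yz≈y*xz)
  open Exp semiring using (_^_; ^-homo-*)
  open SetoidReasoning setoid

  infix  4 _≗ᶜ_
  infixl 7 _⊛_

  _≗ᶜ_ : (f h : Composition → Carrier) → Set ℓ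
  f ≗ᶜ h = ∀ α → f α ≈ h α

  -- The functional M_α ↦ f α times the functional M_α ↦ h α.
  _⊛_ : (f h : Composition → Carrier) → Composition → Carrier
  (f ⊛ h) []      = f [] * h []
  (f ⊛ h) (a ∷ α) = f [] * h (a ∷ α) + ((f ∘ (a ∷_)) ⊛ h) α

  ⊛-cong : ∀ {f f′ h h′} → f ≗ᶜ f′ → h ≗ᶜ h′ → f ⊛ h ≗ᶜ f′ ⊛ h′
  ⊛-cong p q []      = *-cong (p []) (q [])
  ⊛-cong p q (a ∷ α) = +-cong (*-cong (p []) (q (a ∷ α))) (⊛-cong (p ∘ (a ∷_)) q α)

  ⊛-distribʳ-+ : ∀ f f′ h → (λ β → f β + f′ β) ⊛ h ≗ᶜ λ α → (f ⊛ h) α + (f′ ⊛ h) α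
  ⊛-distribʳ-+ f f′ h []      = distribʳ _ _ _
  ⊛-distribʳ-+ f f′ h (a ∷ α) = trans
    (+-cong (distribʳ _ _ _) (⊛-distribʳ-+ (f ∘ (a ∷_)) (f′ ∘ (a ∷_)) h α))
    (interchange _ _ _ _)

  ⊛-*-assoc : ∀ x f h → (λ β → x * f β) ⊛ h ≗ᶜ λ α → x * (f ⊛ h) α
  ⊛-*-assoc x f h []      = *-assoc _ _ _
  ⊛-*-assoc x f h (a ∷ α) = trans
    (+-cong (*-assoc _ _ _) (⊛-*-assoc x (f ∘ (a ∷_)) h α))
    (sym (distribˡ _ _ _))

  ⊛-negˡ : ∀ f h → (λ β → - f β) ⊛ h ≗ᶜ λ α → - (f ⊛ h) α
  ⊛-negˡ f h α = begin
    ((λ β → - f β) ⊛ h) α       ≈⟨ ⊛-cong (λ β → sym (-1*x≈-x (f β))) (λ _ → refl) α ⟩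
    ((λ β → - 1# * f β) ⊛ h) α  ≈⟨ ⊛-*-assoc (- 1#) f h α ⟩
    - 1# * (f ⊛ h) α            ≈⟨ -1*x≈-x _ ⟩
    - (f ⊛ h) α                 ∎

  ⊛-zeroˡ : ∀ {f} h → (∀ β → f β ≈ 0#) → ∀ α → (f ⊛ h) α ≈ 0#
  ⊛-zeroˡ h f≈0 []      = trans (*-congʳ (f≈0 [])) (zeroˡ _)
  ⊛-zeroˡ h f≈0 (a ∷ α) = trans
    (+-cong (trans (*-congʳ (f≈0 [])) (zeroˡ _)) (⊛-zeroˡ h (f≈0 ∘ (a ∷_)) α))
    (+-identityˡ 0#)

  ⊛-scalarˡ : ∀ {f} h → (∀ b β → f (b ∷ β) ≈ 0#) → ∀ α → (f ⊛ h) α ≈ f [] * h α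
  ⊛-scalarˡ h f≈0 []      = refl
  ⊛-scalarˡ h f≈0 (a ∷ α) = trans (+-congˡ (⊛-zeroˡ h (f≈0 a) α)) (+-identityʳ _)

  ⊛-assoc : ∀ f h k → (f ⊛ h) ⊛ k ≗ᶜ f ⊛ (h ⊛ k)
  ⊛-assoc f h k []      = *-assoc _ _ _
  ⊛-assoc f h k (a ∷ α) = begin
    f [] * h [] * k (a ∷ α) + ((λ β → f [] * h (a ∷ β) + (f′ ⊛ h) β) ⊛ k) α
      ≈⟨ +-cong (*-assoc _ _ _) (⊛-distribʳ-+ (λ β → f [] * h (a ∷ β)) (f′ ⊛ h) k α) ⟩
    f [] * (h [] * k (a ∷ α)) + (((λ β → f [] * h (a ∷ β)) ⊛ k) α + ((f′ ⊛ h) ⊛ k) α)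
      ≈⟨ +-congˡ (+-cong (⊛-*-assoc (f []) (h ∘ (a ∷_)) k α) (⊛-assoc f′ h k α)) ⟩
    f [] * (h [] * k (a ∷ α)) + (f [] * ((h ∘ (a ∷_)) ⊛ k) α + (f′ ⊛ (h ⊛ k)) α)
      ≈⟨ +-assoc _ _ _ ⟨
    f [] * (h [] * k (a ∷ α)) + f [] * ((h ∘ (a ∷_)) ⊛ k) α + (f′ ⊛ (h ⊛ k)) α
      ≈⟨ +-congʳ (distribˡ _ _ _) ⟨
    f [] * (h ⊛ k) (a ∷ α) + (f′ ⊛ (h ⊛ k)) α ∎
    where
    f′ = f ∘ (a ∷_)

  counit : Composition → Carrier
  counit []      = 1#
  counit (_ ∷ _) = 0#

  ⊛-identityʳ : ∀ f → f ⊛ counit ≗ᶜ f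
  ⊛-identityʳ f []      = *-identityʳ _
  ⊛-identityʳ f (a ∷ α) = trans
    (+-cong (zeroʳ _) (⊛-identityʳ (f ∘ (a ∷_)) α)) (+-identityˡ _)

  sign : ℕ → Carrier
  sign n = (- 1#) ^ n

  twist : (Composition → Carrier) → Composition → Carrier
  twist f α = sign (size α) * f α

  twist-⊛ : ∀ f h → twist (f ⊛ h) ≗ᶜ twist f ⊛ twist h
  twist-⊛ f h []      = begin
    1# * (f [] * h [])         ≈⟨ *-congʳ (*-identityˡ 1#) ⟨
    1# * 1# * (f [] * h [])    ≈⟨ *-interchange _ _ _ _ ⟩
    1# * f [] * (1# * h [])    ∎
  twist-⊛ f h (a ∷ α) = begin
    sign (size (a ∷ α)) * (f [] * h (a ∷ α) + (f′ ⊛ h) α)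
      ≈⟨ distribˡ _ _ _ ⟩
    sign (size (a ∷ α)) * (f [] * h (a ∷ α)) + sign (size (a ∷ α)) * (f′ ⊛ h) α
      ≈⟨ +-cong (trans (x*yz≈y*xz _ _ _) (*-congʳ (sym (*-identityˡ _))))
                (trans (*-congʳ (^-homo-* (- 1#) (value a) (size α))) (*-assoc _ _ _)) ⟩
    twist f [] * twist h (a ∷ α) + sign (value a) * twist (f′ ⊛ h) α
      ≈⟨ +-congˡ (*-congˡ (twist-⊛ f′ h α)) ⟩
    twist f [] * twist h (a ∷ α) + sign (value a) * (twist f′ ⊛ twist h) α
      ≈⟨ +-congˡ (⊛-*-assoc (sign (value a)) (twist f′) (twist h) α) ⟨
    twist f [] * twist h (a ∷ α) + ((λ β → sign (value a) * twist f′ β) ⊛ twist h) α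
      ≈⟨ +-congˡ (⊛-cong
           (λ β → trans (sym (*-assoc _ _ _)) (*-congʳ (sym (^-homo-* (- 1#) (value a) (size β)))))
           (λ _ → refl) α) ⟩
    (twist f ⊛ twist h) (a ∷ α) ∎
    where
    f′ = f ∘ (a ∷_)

  -- The sum over the cuts of α with a nonempty second piece.
  ⊛-proper : (f h : Composition → Carrier) → Composition → Carrier
  ⊛-proper f h []      = 0#
  ⊛-proper f h (a ∷ α) = f [] * h (a ∷ α) + ⊛-proper (f ∘ (a ∷_)) h α

  ⊛-split : ∀ f h α → (f ⊛ h) α ≈ ⊛-proper f h α + f α * h []
  ⊛-split f h []      = sym (+-identityˡ _)
  ⊛-split f h (a ∷ α) = trans (+-congˡ (⊛-split (f ∘ (a ∷_)) h α)) (sym (+-assoc _ _ _))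

  -- In `⊛-sqrt-unique` a part is put in front of the left piece; the strict bound keeps the result
  -- within the range of the inductive hypothesis.
  ⊛-proper-cong : ∀ {f f′ h h′} α →
    (∀ β → length β ℕ.< length α → f β ≈ f′ β) →
    (∀ β → length β ℕ.≤ length α → h β ≈ h′ β) →
    ⊛-proper f h α ≈ ⊛-proper f′ h′ α
  ⊛-proper-cong []      p q = refl
  ⊛-proper-cong (a ∷ α) p q = +-cong
    (*-cong (p [] (ℕ.s≤s ℕ.z≤n)) (q (a ∷ α) ℕₚ.≤-refl))
    (⊛-proper-cong α (λ β lt → p (a ∷ β) (ℕ.s≤s lt)) (λ β le → q β (ℕₚ.m≤n⇒m≤1+n le)))

  ⊛-congˡ-≤ : ∀ f {h h′} α → (∀ β → length β ℕ.≤ length α → h β ≈ h′ β) →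
              (f ⊛ h) α ≈ (f ⊛ h′) α
  ⊛-congˡ-≤ f []      q = *-congˡ (q [] ℕ.z≤n)
  ⊛-congˡ-≤ f (a ∷ α) q = +-cong (*-congˡ (q (a ∷ α) ℕₚ.≤-refl))
    (⊛-congˡ-≤ (f ∘ (a ∷_)) α (λ β le → q β (ℕₚ.m≤n⇒m≤1+n le)))

  -- The left piece of a cut is a prefix, which is not a structural subterm, hence induction on the
  -- length.
  length-induction : ∀ {p} (P : Composition → Set p) → P [] →
    (∀ a α → (∀ β → length β ℕ.≤ length α → P β) → P (a ∷ α)) → ∀ α → P α
  length-induction P base step α = bounded (length α) α ℕₚ.≤-refl
    where
    bounded : ∀ n β → length β ℕ.≤ n → P β
    bounded n       []      le         = base
    bounded (suc n) (a ∷ β) (ℕ.s≤s le) =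
      step a β λ γ γ≤β → bounded n γ (ℕₚ.≤-trans γ≤β le)

  -- Triangularity: in the product at `a ∷ α` the value `h (a ∷ α)` occurs once, with coefficient 1,
  -- and all other values of `h` are taken at shorter suffixes.
  ⊛-cancelˡ : ∀ f {h h′} → f [] ≈ 1# → f ⊛ h ≗ᶜ f ⊛ h′ → h ≗ᶜ h′
  ⊛-cancelˡ f {h} {h′} f1 eq = length-induction (λ α → h α ≈ h′ α)
    (trans (sym (unit h [])) (trans (eq []) (unit h′ [])))
    λ a α ih → +-cancelʳ (((f ∘ (a ∷_)) ⊛ h) α) _ _ (begin
      h (a ∷ α) + ((f ∘ (a ∷_)) ⊛ h) α   ≈⟨ +-congʳ (unit h (a ∷ α)) ⟨
      (f ⊛ h) (a ∷ α)                    ≈⟨ eq (a ∷ α) ⟩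
      (f ⊛ h′) (a ∷ α)                   ≈⟨ +-cong (unit h′ (a ∷ α)) (sym (⊛-congˡ-≤ (f ∘ (a ∷_)) α ih)) ⟩
      h′ (a ∷ α) + ((f ∘ (a ∷_)) ⊛ h) α  ∎)
    where
    unit : ∀ k α → f [] * k α ≈ k α
    unit k α = trans (*-congʳ f1) (*-identityˡ _)

  -- The value at `a ∷ α` enters the square only through the two extreme cuts, each time with
  -- coefficient 1. The remaining terms involve shorter compositions, so its double is determined.
  ⊛-sqrt-unique : (∀ {x y} → x + x ≈ y + y → x ≈ y) →
    ∀ {f h} → f [] ≈ 1# → h [] ≈ 1# → f ⊛ f ≗ᶜ h ⊛ h → f ≗ᶜ h
  ⊛-sqrt-unique halve {f} {h} f1 h1 eq = length-induction (λ α → f α ≈ h α)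
    (trans f1 (sym h1))
    λ a α ih → halve (+-cancelˡ (⊛-proper (f ∘ (a ∷_)) f α) _ _ (begin
      ⊛-proper (f ∘ (a ∷_)) f α + (f (a ∷ α) + f (a ∷ α)) ≈⟨ square f f1 a α ⟨
      (f ⊛ f) (a ∷ α)                                     ≈⟨ eq (a ∷ α) ⟩
      (h ⊛ h) (a ∷ α)                                     ≈⟨ square h h1 a α ⟩
      ⊛-proper (h ∘ (a ∷_)) h α + (h (a ∷ α) + h (a ∷ α))
        ≈⟨ +-congʳ (⊛-proper-cong α (λ β lt → sym (ih (a ∷ β) lt)) (λ β le → sym (ih β le))) ⟩
      ⊛-proper (f ∘ (a ∷_)) f α + (h (a ∷ α) + h (a ∷ α)) ∎))
    where
    square : ∀ k → k [] ≈ 1# → ∀ a α →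
      (k ⊛ k) (a ∷ α) ≈ ⊛-proper (k ∘ (a ∷_)) k α + (k (a ∷ α) + k (a ∷ α))
    square k k1 a α = begin
      k [] * k (a ∷ α) + ((k ∘ (a ∷_)) ⊛ k) α
        ≈⟨ +-cong (trans (*-congʳ k1) (*-identityˡ _)) (⊛-split (k ∘ (a ∷_)) k α) ⟩
      k (a ∷ α) + (⊛-proper (k ∘ (a ∷_)) k α + k (a ∷ α) * k [])
        ≈⟨ +-congˡ (+-congˡ (trans (*-congˡ k1) (*-identityʳ _))) ⟩
      k (a ∷ α) + (⊛-proper (k ∘ (a ∷_)) k α + k (a ∷ α))
        ≈⟨ x∙yz≈y∙xz _ _ _ ⟩
      ⊛-proper (k ∘ (a ∷_)) k α + (k (a ∷ α) + k (a ∷ α)) ∎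

-- Functionals that depend on the parities of the parts

module OddCharacter {c ℓ} (R : CommutativeRing c ℓ) where

  open CommutativeRing R
  open RingProperties ring using (-‿distribʳ-*; -0#≈0#; -1*x≈-x; -‿involutive)
  open AbelianGroupProperties +-abelianGroup using () renaming (⁻¹-∙-comm to -‿+-comm)
  open Convolution commutativeSemiring
  open Deconcatenation R
  open SetoidReasoning setoid

  Sequence : Set c
  Sequence = ℕ → Carrier

  -- With U read as the linear form t^k ↦ U k on polynomials, weigh K true U α
  -- applies U to the product of a factor t for each odd part of α and a
  -- factor −1 for each even part; K receives the shifted sequence, and
  -- whether the last part was odd (or absent).
  weigh : (K : Bool → Sequence → Carrier) → Bool → Sequence → Composition → Carrier
  weighRest : (K : Bool → Sequence → Carrier) → Bool → Sequence → Composition → Carrier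

  weigh K e U []      = K e U
  weigh K e U (a ∷ α) = weighRest K (hasOddValue a) U α

  weighRest K true  U α = weigh K true (U ∘ suc) α
  weighRest K false U α = - weigh K false U α

  -- The terminal continuation: after one shift per odd part, the entry at 0 is the original `U` at
  -- the number of odd parts. The flag sends compositions ending in an even part to 0.
  first : Bool → Sequence → Carrier
  first e U = if e then U 0 else 0#

  -- For U k = 4^{-⌊k/2⌋} C(0,⌊k/2⌋) this is α ↦ ζ₋(M_α).
  η : Bool → Sequence → Composition → Carrier
  η = weigh first

  η-cong : ∀ e {U V} α → (∀ k → U k ≈ V k) → η e U α ≈ η e V α
  η-cong true  []      p = p 0
  η-cong false []      p = refl
  η-cong e     (a ∷ α) p with hasOddValue a
  ... | true  = η-cong true α (p ∘ suc)
  ... | false = -‿cong (η-cong false α p)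

  η-+ : ∀ e U V α → η e (λ k → U k + V k) α ≈ η e U α + η e V α
  η-+ true  U V []      = refl
  η-+ false U V []      = sym (+-identityʳ 0#)
  η-+ e     U V (a ∷ α) with hasOddValue a
  ... | true  = η-+ true (U ∘ suc) (V ∘ suc) α
  ... | false = trans (-‿cong (η-+ false U V α)) (sym (-‿+-comm _ _))

  η-* : ∀ e x U α → η e (λ k → x * U k) α ≈ x * η e U α
  η-* true  x U []      = refl
  η-* false x U []      = sym (zeroʳ x)
  η-* e     x U (a ∷ α) with hasOddValue a
  ... | true  = η-* true x (U ∘ suc) α
  ... | false = trans (-‿cong (η-* false x U α)) (-‿distribʳ-* _ _)

  η-sub : ∀ e U V α → η e (λ k → U k - V k) α ≈ η e U α - η e V α
  η-sub e U V α = begin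
    η e (λ k → U k - V k) α           ≈⟨ η-+ e U (λ k → - V k) α ⟩
    η e U α + η e (λ k → - V k) α     ≈⟨ +-congˡ (η-cong e α λ k → sym (-1*x≈-x (V k))) ⟩
    η e U α + η e (λ k → - 1# * V k) α ≈⟨ +-congˡ (trans (η-* e (- 1#) V α) (-1*x≈-x _)) ⟩
    η e U α - η e V α                 ∎

  η-zero : ∀ e {U} α → (∀ k → U k ≈ 0#) → η e U α ≈ 0#
  η-zero true  []      p = p 0
  η-zero false []      p = refl
  η-zero e     (a ∷ α) p with hasOddValue a
  ... | true  = η-zero true α (p ∘ suc)
  ... | false = trans (-‿cong (η-zero false α p)) -0#≈0#

  η-⊛-η : ∀ U V → η true U ⊛ η true V ≗ᶜ η true (conv U V)
  -- The first summand is the cut with empty left piece, carried past the even parts read so far.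
  -- The cut directly behind such a part drops out, since `η false U []` is 0.
  η-⊛-η-false : ∀ U V α →
    U 0 * η false V α + (η false U ⊛ η true V) α ≈ η false (conv U V) α
  η-⊛-η-rest : ∀ b U V α →
    U 0 * weighRest first b V α + (weighRest first b U ⊛ η true V) α ≈
    weighRest first b (conv U V) α

  η-⊛-η U V []      = refl
  η-⊛-η U V (a ∷ α) = η-⊛-η-rest (hasOddValue a) U V α

  η-⊛-η-false U V []      = trans (+-cong (zeroʳ _) (zeroˡ _)) (+-identityˡ _)
  η-⊛-η-false U V (a ∷ α) = trans
    (+-congˡ (trans (+-congʳ (zeroˡ _)) (+-identityˡ _)))
    (η-⊛-η-rest (hasOddValue a) U V α)

  η-⊛-η-rest true U V α = begin
    U 0 * η true (V ∘ suc) α + (η true (U ∘ suc) ⊛ η true V) α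
      ≈⟨ +-cong (sym (η-* true (U 0) (V ∘ suc) α)) (η-⊛-η (U ∘ suc) V α) ⟩
    η true (λ k → U 0 * V (suc k)) α + η true (conv (U ∘ suc) V) α
      ≈⟨ η-+ true (λ k → U 0 * V (suc k)) (conv (U ∘ suc) V) α ⟨
    η true (conv U V ∘ suc) α ∎
  η-⊛-η-rest false U V α = begin
    U 0 * - η false V α + ((λ β → - η false U β) ⊛ η true V) α
      ≈⟨ +-cong (sym (-‿distribʳ-* _ _)) (⊛-negˡ (η false U) (η true V) α) ⟩
    - (U 0 * η false V α) - (η false U ⊛ η true V) α
      ≈⟨ -‿+-comm _ _ ⟩
    - (U 0 * η false V α + (η false U ⊛ η true V) α)
      ≈⟨ -‿cong (η-⊛-η-false U V α) ⟩
    - η false (conv U V) α ∎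

  sign-value : ∀ a → sign (value a) ≈ (if hasOddValue a then - 1# else 1#)
  sign-value (1+ a) = sign-suc a
    where
    double-negation : ∀ x → - 1# * (- 1# * x) ≈ x
    double-negation x = trans (-1*x≈-x _) (trans (-‿cong (-1*x≈-x x)) (-‿involutive x))
    sign-suc : ∀ a → sign (suc a) ≈ (if isEven a then - 1# else 1#)
    sign-suc zero          = *-identityʳ _
    sign-suc (suc zero)    = double-negation 1#
    sign-suc (suc (suc a)) = trans (double-negation _) (sign-suc a)

  ζ^ : Composition → Carrier
  ζ^ []          = 1#
  ζ^ (_ ∷ [])    = 1#
  ζ^ (_ ∷ _ ∷ _) = 0#

  -- ζ vanishes on compositions with more than one part, so only the first two cuts contribute.
  twist-ζ^-⊛ : ∀ h a α → (twist ζ^ ⊛ h) (a ∷ α) ≈ h (a ∷ α) + sign (value a) * h α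
  twist-ζ^-⊛ h a α = +-cong
    (trans (*-congʳ (*-identityˡ 1#)) (*-identityˡ _))
    (trans (⊛-scalarˡ h (λ b β → zeroʳ _) α)
           (*-congʳ (trans (*-identityʳ _) (reflexive (≡.cong sign (ℕₚ.+-identityʳ (value a)))))))

  difference : Sequence → Sequence
  difference U k = U (suc k) - U k

  scaledCounit : Carrier → Composition → Carrier
  scaledCounit x []      = x
  scaledCounit x (_ ∷ _) = 0#

  -- For the sequence U of ζ₋ this is α ↦ ζ₊(M_α).
  θ : Sequence → Composition → Carrier
  θ U []      = U 0
  θ U (a ∷ α) =
    if hasOddValue a then η true (difference U) α else scaledCounit (U 0) α

  -- The two surviving cuts differ by a shift of `U` if the first part is odd. If it is even they
  -- cancel unless `α` is empty, because `η` looks at its flag only at the empty composition.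
  twist-ζ^-⊛-η : ∀ U → twist ζ^ ⊛ η true U ≗ᶜ θ U
  twist-ζ^-⊛-η U []      = trans (*-congʳ (*-identityˡ 1#)) (*-identityˡ _)
  twist-ζ^-⊛-η U (a ∷ α) = trans (twist-ζ^-⊛ (η true U) a α)
    (trans (+-congˡ (*-congʳ (sign-value a))) (parity (hasOddValue a)))
    where
    even : ∀ α → - η false U α + η true U α ≈ scaledCounit (U 0) α
    even []      = trans (+-congʳ -0#≈0#) (+-identityˡ _)
    even (_ ∷ _) = -‿inverseˡ _
    parity : ∀ b → weighRest first b U α + (if b then - 1# else 1#) * η true U α ≈
             (if b then η true (difference U) α else scaledCounit (U 0) α)
    parity true  = trans (+-congˡ (-1*x≈-x _)) (sym (η-sub true (U ∘ suc) U α))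
    parity false = trans (+-congˡ (*-identityˡ _)) (even α)

  -- As a linear form, `D` is a multiple of evaluation at t = 0, which kills every composition with
  -- an odd part. A nonempty composition without odd parts ends in an even part and has weight 0
  -- anyway.
  η-impulse : ∀ {D} → (∀ k → D (suc k) ≈ 0#) → ∀ α → η true D α ≈ scaledCounit (D 0) α
  η-impulse′ : ∀ {D} → (∀ k → D (suc k) ≈ 0#) → ∀ α → η false D α ≈ 0#
  η-impulse-rest : ∀ {D} → (∀ k → D (suc k) ≈ 0#) → ∀ b α → weighRest first b D α ≈ 0#
  η-impulse p []      = refl
  η-impulse p (a ∷ α) = η-impulse-rest p (hasOddValue a) α
  η-impulse′ p []      = refl
  η-impulse′ p (a ∷ α) = η-impulse-rest p (hasOddValue a) α
  η-impulse-rest p true  α = η-zero true α p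
  η-impulse-rest p false α = trans (-‿cong (η-impulse′ p α)) -0#≈0#

  -- `W` is the coefficient sequence 1, 2, 2, ... of (1 + t)/(1 - t); its difference sequence is 1,
  -- 0, 0, ..., to which `η-impulse` applies.
  θ-ζ^ : ∀ {W} → W 0 ≈ 1# → (∀ k → W (suc k) ≈ 1# + 1#) → θ W ≗ᶜ ζ^
  θ-ζ^ W0 W+ []      = W0
  θ-ζ^ {W} W0 W+ (a ∷ α) with hasOddValue a
  ... | true  = trans
    (η-impulse (λ k → trans (+-cong (W+ (suc k)) (-‿cong (W+ k))) (-‿inverseʳ _)) α) (unit α)
    where
    unit : ∀ α → scaledCounit (W 1 - W 0) α ≈ ζ^ (a ∷ α)
    unit []      = trans (+-cong (W+ 0) (-‿cong W0))
      (trans (+-assoc _ _ _) (trans (+-congˡ (-‿inverseʳ 1#)) (+-identityʳ 1#)))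
    unit (_ ∷ _) = refl
  ... | false = unit α
    where
    unit : ∀ α → scaledCounit (W 0) α ≈ ζ^ (a ∷ α)
    unit []      = W0
    unit (_ ∷ _) = refl

  module Factorisation
    (halve : ∀ {x y} → x + x ≈ y + y → x ≈ y)
    {U : Sequence} (U0 : U 0 ≈ 1#) (U*U : ∀ k → conv U U (suc k) ≈ 1# + 1#)
    {z₊ z₋ : Composition → Carrier}
    (z₊-even : twist z₊ ≗ᶜ z₊) (z₋-odd : twist z₋ ⊛ z₋ ≗ᶜ counit)
    (z₋-unit : z₋ [] ≈ 1#)
    (factorisation : ζ^ ≗ᶜ z₊ ⊛ z₋)
    where

    z₊≗ζ̄⊛z₋ : z₊ ≗ᶜ twist ζ^ ⊛ z₋
    z₊≗ζ̄⊛z₋ α = begin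
      z₊ α                            ≈⟨ ⊛-identityʳ z₊ α ⟨
      (z₊ ⊛ counit) α                 ≈⟨ ⊛-cong (λ β → sym (z₊-even β)) (λ β → sym (z₋-odd β)) α ⟩
      (twist z₊ ⊛ (twist z₋ ⊛ z₋)) α  ≈⟨ ⊛-assoc (twist z₊) (twist z₋) z₋ α ⟨
      (twist z₊ ⊛ twist z₋ ⊛ z₋) α    ≈⟨ ⊛-cong (λ β → sym (twist-⊛ z₊ z₋ β)) (λ _ → refl) α ⟩
      (twist (z₊ ⊛ z₋) ⊛ z₋) α        ≈⟨ ⊛-cong (λ β → *-congˡ (sym (factorisation β))) (λ _ → refl) α ⟩
      (twist ζ^ ⊛ z₋) α               ∎

    -- Both ζ̄ z₋² and ζ̄ η² equal ζ. Cancelling ζ̄ and comparing square roots avoids inverting ζ̄.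
    z₋≗η : z₋ ≗ᶜ η true U
    z₋≗η = ⊛-sqrt-unique halve z₋-unit U0 (⊛-cancelˡ (twist ζ^) (*-identityˡ 1#) λ α → begin
      (twist ζ^ ⊛ (z₋ ⊛ z₋)) α         ≈⟨ ⊛-assoc (twist ζ^) z₋ z₋ α ⟨
      (twist ζ^ ⊛ z₋ ⊛ z₋) α           ≈⟨ ⊛-cong (λ β → sym (z₊≗ζ̄⊛z₋ β)) (λ _ → refl) α ⟩
      (z₊ ⊛ z₋) α                      ≈⟨ factorisation α ⟨
      ζ^ α                             ≈⟨ θ-ζ^ (trans (*-cong U0 U0) (*-identityˡ 1#)) U*U α ⟨
      θ (conv U U) α                   ≈⟨ twist-ζ^-⊛-η (conv U U) α ⟨
      (twist ζ^ ⊛ η true (conv U U)) α ≈⟨ ⊛-cong (λ _ → refl) (λ β → sym (η-⊛-η U U β)) α ⟩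
      (twist ζ^ ⊛ (η true U ⊛ η true U)) α ∎)

    z₊≗θ : z₊ ≗ᶜ θ U
    z₊≗θ α = begin
      z₊ α                     ≈⟨ z₊≗ζ̄⊛z₋ α ⟩
      (twist ζ^ ⊛ z₋) α        ≈⟨ ⊛-cong (λ _ → refl) z₋≗η α ⟩
      (twist ζ^ ⊛ η true U) α  ≈⟨ twist-ζ^-⊛-η U α ⟩
      θ U α                    ∎

-- Sums over refinements

module Refinements {c ℓ} (R : CommutativeRing c ℓ) where

  open CommutativeRing R
  open RingProperties ring using (-0#≈0#)
  open AbelianGroupProperties +-abelianGroup using () renaming (⁻¹-∙-comm to -‿+-comm)
  open CommutativeSemigroupProperties +-commutativeSemigroup using (interchange)
  open GroupProperties +-group using (//-rightDividesˡ)
  open Deconcatenation R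
  open OddCharacter R
  open SetoidReasoning setoid

  ∑ˡ : ∀ {a} {A : Set a} → (A → Carrier) → List A → Carrier
  ∑ˡ f = foldr (λ x s → f x + s) 0#

  module _ {a} {A : Set a} where

    ∑ˡ-cong : ∀ {f h : A → Carrier} → (∀ x → f x ≈ h x) → ∀ xs → ∑ˡ f xs ≈ ∑ˡ h xs
    ∑ˡ-cong p []       = refl
    ∑ˡ-cong p (x ∷ xs) = +-cong (p x) (∑ˡ-cong p xs)

    ∑ˡ-zero : ∀ {f : A → Carrier} → (∀ x → f x ≈ 0#) → ∀ xs → ∑ˡ f xs ≈ 0#
    ∑ˡ-zero p []       = refl
    ∑ˡ-zero p (x ∷ xs) = trans (+-cong (p x) (∑ˡ-zero p xs)) (+-identityˡ 0#)

    ∑ˡ-+ : ∀ (f h : A → Carrier) xs → ∑ˡ (λ x → f x + h x) xs ≈ ∑ˡ f xs + ∑ˡ h xs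
    ∑ˡ-+ f h []       = sym (+-identityˡ 0#)
    ∑ˡ-+ f h (x ∷ xs) = trans (+-congˡ (∑ˡ-+ f h xs)) (interchange _ _ _ _)

    ∑ˡ-neg : ∀ (f : A → Carrier) xs → ∑ˡ (λ x → - f x) xs ≈ - ∑ˡ f xs
    ∑ˡ-neg f []       = sym -0#≈0#
    ∑ˡ-neg f (x ∷ xs) = trans (+-congˡ (∑ˡ-neg f xs)) (-‿+-comm _ _)

    ∑ˡ-++ : ∀ (f : A → Carrier) xs ys → ∑ˡ f (xs ++ ys) ≈ ∑ˡ f xs + ∑ˡ f ys
    ∑ˡ-++ f []       ys = sym (+-identityˡ _)
    ∑ˡ-++ f (x ∷ xs) ys = trans (+-congˡ (∑ˡ-++ f xs ys)) (sym (+-assoc _ _ _))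

    module _ {b} {B : Set b} where

      ∑ˡ-map : ∀ (f : A → Carrier) (k : B → A) ys → ∑ˡ f (map k ys) ≈ ∑ˡ (f ∘ k) ys
      ∑ˡ-map f k []       = refl
      ∑ˡ-map f k (y ∷ ys) = +-congˡ (∑ˡ-map f k ys)

      ∑ˡ-concatMap : ∀ (f : A → Carrier) (k : B → List A) ys →
                     ∑ˡ f (concatMap k ys) ≈ ∑ˡ (∑ˡ f ∘ k) ys
      ∑ˡ-concatMap f k []       = refl
      ∑ˡ-concatMap f k (y ∷ ys) = trans (∑ˡ-++ f (k y) (concatMap k ys)) (+-congˡ (∑ˡ-concatMap f k ys))

  -- Mirrors the second branch of `extend`; the empty composition has no first part to enlarge,
  -- hence the value 0.
  enlarged : (Composition → Carrier) → Composition → Carrier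
  enlarged f []           = 0#
  enlarged f ((1+ a) ∷ α) = f ((1+ suc a) ∷ α)

  ∑-compositions-suc : ∀ f n →
    ∑ˡ f (compositions (suc n)) ≈
    ∑ˡ (f ∘ ((1+ 0) ∷_)) (compositions n) + ∑ˡ (enlarged f) (compositions n)
  ∑-compositions-suc f n = begin
    ∑ˡ f (concatMap extend (compositions n))
      ≈⟨ ∑ˡ-concatMap f extend (compositions n) ⟩
    ∑ˡ (∑ˡ f ∘ extend) (compositions n)
      ≈⟨ ∑ˡ-cong ∑-extend (compositions n) ⟩
    ∑ˡ (λ γ → f ((1+ 0) ∷ γ) + enlarged f γ) (compositions n)
      ≈⟨ ∑ˡ-+ (f ∘ ((1+ 0) ∷_)) (enlarged f) (compositions n) ⟩
    ∑ˡ (f ∘ ((1+ 0) ∷_)) (compositions n) + ∑ˡ (enlarged f) (compositions n) ∎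
    where
    ∑-extend : ∀ γ → ∑ˡ f (extend γ) ≈ f ((1+ 0) ∷ γ) + enlarged f γ
    ∑-extend []           = refl
    ∑-extend ((1+ a) ∷ γ) = +-congˡ (+-identityʳ _)

  enlarged-cong : ∀ {f h} → (∀ b γ → f (b ∷ γ) ≈ h (b ∷ γ)) → ∀ γ → enlarged f γ ≈ enlarged h γ
  enlarged-cong p []           = refl
  enlarged-cong p ((1+ a) ∷ γ) = p (1+ suc a) γ

  -- All compositions of `suc n` are nonempty, so the values at `[]` do not enter.
  ∑-compositions-cong : ∀ {f h} → (∀ b γ → f (b ∷ γ) ≈ h (b ∷ γ)) → ∀ n →
    ∑ˡ f (compositions (suc n)) ≈ ∑ˡ h (compositions (suc n))
  ∑-compositions-cong {f} {h} p n = trans (∑-compositions-suc f n) (trans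
    (+-cong (∑ˡ-cong (p (1+ 0)) (compositions n)) (∑ˡ-cong (enlarged-cong p) (compositions n)))
    (sym (∑-compositions-suc h n)))

  ∑-compositions-zero : ∀ {f} → (∀ b γ → f (b ∷ γ) ≈ 0#) → ∀ n →
    ∑ˡ f (compositions (suc n)) ≈ 0#
  ∑-compositions-zero p n =
    trans (∑-compositions-cong p n) (∑ˡ-zero (λ _ → refl) (compositions (suc n)))

  -- The weight of a part depends on its parity only, and a part 2 contributes
  -- a factor −1; so among the compositions of n + 3 those with first part 2
  -- cancel those with first part ≥ 3.
  ∑-enlarged-weigh : ∀ K e U n → ∑ˡ (enlarged (weigh K e U)) (compositions (2 ℕ.+ n)) ≈ 0#
  ∑-enlarged-weigh K e U n = begin
    ∑ˡ (enlarged f) (compositions (2 ℕ.+ n))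
      ≈⟨ ∑-compositions-suc (enlarged f) (suc n) ⟩
    ∑ˡ (λ γ → - weigh K false U γ) (compositions (suc n)) +
      ∑ˡ (enlarged (enlarged f)) (compositions (suc n))
      ≈⟨ ∑ˡ-+ _ _ (compositions (suc n)) ⟨
    ∑ˡ (λ γ → - weigh K false U γ + enlarged (enlarged f) γ) (compositions (suc n))
      ≈⟨ ∑-compositions-zero (λ { (1+ a) γ → -‿inverseˡ _ }) n ⟩
    0# ∎
    where f = weigh K e U

  ∑-weigh-1 : ∀ K e U → ∑ˡ (weigh K e U) (compositions 1) ≈ K true (U ∘ suc)
  ∑-weigh-1 K e U = +-identityʳ _

  -- After the cancellation two compositions of n + 2 are left: all parts 1, with factor t^(n+2),
  -- and n parts 1 followed by a part 2, with factor -t^n. The flags passed to `K` are the parities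
  -- of their last parts.
  ∑-weigh-2+ : ∀ K e U n → ∑ˡ (weigh K e U) (compositions (2 ℕ.+ n)) ≈
               K true (λ k → U (2 ℕ.+ n ℕ.+ k)) - K false (λ k → U (n ℕ.+ k))
  ∑-weigh-2+ K e U zero    = +-congˡ (+-identityʳ _)
  ∑-weigh-2+ K e U (suc n) = begin
    ∑ˡ (weigh K e U) (compositions (3 ℕ.+ n))
      ≈⟨ ∑-compositions-suc (weigh K e U) (2 ℕ.+ n) ⟩
    ∑ˡ (weigh K true (U ∘ suc)) (compositions (2 ℕ.+ n)) +
      ∑ˡ (enlarged (weigh K e U)) (compositions (2 ℕ.+ n))
      ≈⟨ +-cong (∑-weigh-2+ K true (U ∘ suc) n) (∑-enlarged-weigh K e U n) ⟩
    K true (λ k → U (3 ℕ.+ n ℕ.+ k)) - K false (λ k → U (suc n ℕ.+ k)) + 0#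
      ≈⟨ +-identityʳ _ ⟩
    K true (λ k → U (3 ℕ.+ n ℕ.+ k)) - K false (λ k → U (suc n ℕ.+ k)) ∎

  -- The analogue of `weigh` for `θ`, applied to the block that refines the first part: `κ` is what
  -- the later blocks contribute when this one is a single even part. Blocks are nonempty, and the
  -- value at `[]` is only a default.
  weighθ : (K : Bool → Sequence → Carrier) → Carrier → Sequence → Composition → Carrier
  weighθ K κ V []      = 0#
  weighθ K κ V (a ∷ γ) = if hasOddValue a then weigh K true V γ else scaledCounit κ γ

  ∑-weighθ-1 : ∀ K κ V → ∑ˡ (weighθ K κ V) (compositions 1) ≈ K true V
  ∑-weighθ-1 K κ V = +-identityʳ _

  ∑-weighθ-2 : ∀ K κ V → ∑ˡ (weighθ K κ V) (compositions 2) ≈ K true (V ∘ suc) + κ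
  ∑-weighθ-2 K κ V = +-congˡ (+-identityʳ _)

  -- Sorted by the first part: 1 leaves a sum of `weigh`; 2 gives 0, because further parts of the
  -- block follow; a first part of at least 3 can be lowered by 2 without changing its parity.
  ∑-weighθ-3+ : ∀ K κ V n → ∑ˡ (weighθ K κ V) (compositions (3 ℕ.+ n)) ≈
    (K true (λ k → V (2 ℕ.+ n ℕ.+ k)) - K false (λ k → V (n ℕ.+ k))) +
    ∑ˡ (weighθ K κ V) (compositions (suc n))
  ∑-weighθ-3+ K κ V n = begin
    ∑ˡ f (compositions (3 ℕ.+ n))
      ≈⟨ ∑-compositions-suc f (2 ℕ.+ n) ⟩
    ∑ˡ (weigh K true V) (compositions (2 ℕ.+ n)) + ∑ˡ (enlarged f) (compositions (2 ℕ.+ n))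
      ≈⟨ +-cong (∑-weigh-2+ K true V n) (begin
        ∑ˡ (enlarged f) (compositions (2 ℕ.+ n))
          ≈⟨ ∑-compositions-suc (enlarged f) (suc n) ⟩
        ∑ˡ (scaledCounit κ) (compositions (suc n)) +
          ∑ˡ (enlarged (enlarged f)) (compositions (suc n))
          ≈⟨ +-cong (∑-compositions-zero (λ _ _ → refl) n)
                    (∑-compositions-cong (λ { (1+ a) γ → refl }) n) ⟩
        0# + ∑ˡ f (compositions (suc n))
          ≈⟨ +-identityˡ _ ⟩
        ∑ˡ f (compositions (suc n)) ∎) ⟩
    (K true (λ k → V (2 ℕ.+ n ℕ.+ k)) - K false (λ k → V (n ℕ.+ k))) +
      ∑ˡ f (compositions (suc n)) ∎
    where f = weighθ K κ V

  ∑-refinements-∷ : ∀ f a α →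
    ∑ˡ f (refinements (a ∷ α)) ≈
    ∑ˡ (λ γ → ∑ˡ (λ β → f (γ ++ β)) (refinements α)) (compositions (value a))
  ∑-refinements-∷ f a α = trans
    (∑ˡ-concatMap f (λ γ → map (γ ++_) (refinements α)) (compositions (value a)))
    (∑ˡ-cong (λ γ → ∑ˡ-map f (γ ++_) (refinements α)) (compositions (value a)))

  ∑η : Composition → Bool → Sequence → Carrier
  ∑η α e U = ∑ˡ (η e U) (refinements α)

  -- The reason why `weigh` takes a continuation: the sum over the refinements of the remaining
  -- parts is done first and then plays the role of `first` for the block `γ`.
  ∑-η-++ : ∀ βs e U γ → ∑ˡ (λ β → η e U (γ ++ β)) βs ≈ weigh (λ e U → ∑ˡ (η e U) βs) e U γ
  ∑-η-++ βs e U []      = refl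
  ∑-η-++ βs e U (a ∷ γ) with hasOddValue a
  ... | true  = ∑-η-++ βs true (U ∘ suc) γ
  ... | false = trans (∑ˡ-neg _ βs) (-‿cong (∑-η-++ βs false U γ))

  ∑η-∷ : ∀ a α e U → ∑η (a ∷ α) e U ≈ ∑ˡ (weigh (∑η α) e U) (compositions (value a))
  ∑η-∷ a α e U = trans (∑-refinements-∷ (η e U) a α)
    (∑ˡ-cong (∑-η-++ (refinements α) e U) (compositions (value a)))

  -- The value of the linear form t^k ↦ `U k` at t^k (t² - 1)^p.
  Δ² : ℕ → Sequence → Sequence
  Δ² zero    U k = U k
  Δ² (suc p) U k = Δ² p U (2 ℕ.+ k) - Δ² p U k

  Δ²-shift : ∀ p U a k → Δ² p (λ j → U (a ℕ.+ j)) k ≈ Δ² p U (a ℕ.+ k)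
  Δ²-shift zero    U a k = refl
  Δ²-shift (suc p) U a k = +-cong
    (trans (Δ²-shift p U a (2 ℕ.+ k))
      (reflexive (≡.cong (Δ² p U) (≡.trans (ℕₚ.+-suc a (suc k)) (≡.cong suc (ℕₚ.+-suc a k))))))
    (-‿cong (Δ²-shift p U a k))

  -- n − 2 p₋(α) for a composition α of n.
  slack : Composition → ℕ
  slack []                           = 0
  slack (a ∷ [])                     = value a
  slack ((1+ zero)  ∷ α@(_ ∷ _))     = suc (slack α)
  slack ((1+ suc a) ∷ α@(_ ∷ _))     = a ℕ.+ slack α

  -- The right side is the same for both flags, so the two terms of `∑-weigh-2+` combine to a factor
  -- t^(a-2) (t² - 1) when further parts follow. Behind the last part the continuation vanishes at
  -- the flag `false`, which leaves t^a alone.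
  ∑η-Δ² : ∀ a α e U → ∑η (a ∷ α) e U ≈ Δ² (p₋ (a ∷ α)) U (slack (a ∷ α))
  ∑η-Δ² (1+ zero) [] e U = trans (∑η-∷ (1+ 0) [] e U) (trans (∑-weigh-1 (∑η []) e U) (+-identityʳ _))
  ∑η-Δ² (1+ suc a) [] e U = begin
    ∑η ((1+ suc a) ∷ []) e U
      ≈⟨ ∑η-∷ (1+ suc a) [] e U ⟩
    ∑ˡ (weigh (∑η []) e U) (compositions (2 ℕ.+ a))
      ≈⟨ ∑-weigh-2+ (∑η []) e U a ⟩
    (U (2 ℕ.+ a ℕ.+ 0) + 0#) - (0# + 0#)
      ≈⟨ +-cong (trans (+-identityʳ _) (reflexive (≡.cong U (ℕₚ.+-identityʳ (2 ℕ.+ a)))))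
                (trans (-‿cong (+-identityˡ 0#)) -0#≈0#) ⟩
    U (2 ℕ.+ a) + 0#
      ≈⟨ +-identityʳ _ ⟩
    U (2 ℕ.+ a) ∎
  ∑η-Δ² (1+ zero) α@(b ∷ β) e U = begin
    ∑η ((1+ 0) ∷ α) e U                          ≈⟨ ∑η-∷ (1+ 0) α e U ⟩
    ∑ˡ (weigh (∑η α) e U) (compositions 1)       ≈⟨ ∑-weigh-1 (∑η α) e U ⟩
    ∑η α true (U ∘ suc)                          ≈⟨ ∑η-Δ² b β true (U ∘ suc) ⟩
    Δ² (p₋ α) (U ∘ suc) (slack α)                ≈⟨ Δ²-shift (p₋ α) U 1 (slack α) ⟩
    Δ² (p₋ α) U (suc (slack α))                  ∎
  ∑η-Δ² (1+ suc a) α@(b ∷ β) e U = begin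
    ∑η ((1+ suc a) ∷ α) e U
      ≈⟨ ∑η-∷ (1+ suc a) α e U ⟩
    ∑ˡ (weigh (∑η α) e U) (compositions (2 ℕ.+ a))
      ≈⟨ ∑-weigh-2+ (∑η α) e U a ⟩
    ∑η α true (λ k → U (2 ℕ.+ a ℕ.+ k)) - ∑η α false (λ k → U (a ℕ.+ k))
      ≈⟨ +-cong (∑η-Δ² b β true _) (-‿cong (∑η-Δ² b β false _)) ⟩
    Δ² (p₋ α) (λ k → U (2 ℕ.+ a ℕ.+ k)) (slack α) - Δ² (p₋ α) (λ k → U (a ℕ.+ k)) (slack α)
      ≈⟨ +-cong (Δ²-shift (p₋ α) U (2 ℕ.+ a) (slack α)) (-‿cong (Δ²-shift (p₋ α) U a (slack α))) ⟩
    Δ² (p₋ α) U (2 ℕ.+ (a ℕ.+ slack α)) - Δ² (p₋ α) U (a ℕ.+ slack α) ∎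

  size-slack : ∀ α → size α ≡ 2 ℕ* p₋ α ℕ.+ slack α
  size-slack []                       = ≡.refl
  size-slack ((1+ a) ∷ [])            = ℕₚ.+-identityʳ (suc a)
  size-slack ((1+ zero)  ∷ α@(_ ∷ _)) =
    ≡.trans (≡.cong suc (size-slack α)) (≡.sym (ℕₚ.+-suc (2 ℕ* p₋ α) (slack α)))
  size-slack ((1+ suc a) ∷ α@(_ ∷ _)) =
    ≡.trans (≡.cong (2 ℕ.+ a ℕ.+_) (size-slack α)) (regroup a (p₋ α) (slack α))
    where
    regroup : ∀ a p r → 2 ℕ.+ a ℕ.+ (2 ℕ* p ℕ.+ r) ≡ 2 ℕ* suc p ℕ.+ (a ℕ.+ r)
    regroup = solve-∀

  size-∷∷ : ∀ a b α →
    size ((1+ a) ∷ b ∷ α) ≡ 2 ℕ* p₋ (b ∷ α) ℕ.+ suc (a ℕ.+ slack (b ∷ α))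
  size-∷∷ a b α =
    ≡.trans (≡.cong (suc a ℕ.+_) (size-slack (b ∷ α))) (regroup a (p₋ (b ∷ α)) (slack (b ∷ α)))
    where
    regroup : ∀ a p r → suc a ℕ.+ (2 ℕ* p ℕ.+ r) ≡ 2 ℕ* p ℕ.+ suc (a ℕ.+ r)
    regroup = solve-∀

  ∑θ-∷ : ∀ a α U → ∑ˡ (θ U) (refinements (a ∷ α)) ≈
    ∑ˡ (weighθ (∑η α) (∑ˡ (scaledCounit (U 0)) (refinements α)) (difference U))
      (compositions (value a))
  ∑θ-∷ a α U = trans (∑-refinements-∷ (θ U) a α)
    (∑-compositions-cong ∑-θ-++ (ℕ⁺.predecessor a))
    where
    V = difference U
    ∑-scaledCounit-++ : ∀ γ → ∑ˡ (λ β → scaledCounit (U 0) (γ ++ β)) (refinements α) ≈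
                              scaledCounit (∑ˡ (scaledCounit (U 0)) (refinements α)) γ
    ∑-scaledCounit-++ []      = refl
    ∑-scaledCounit-++ (_ ∷ _) = ∑ˡ-zero (λ _ → refl) (refinements α)
    ∑-θ-++ : ∀ b γ → ∑ˡ (λ β → θ U (b ∷ γ ++ β)) (refinements α) ≈
                     weighθ (∑η α) (∑ˡ (scaledCounit (U 0)) (refinements α)) V (b ∷ γ)
    ∑-θ-++ b γ with hasOddValue b
    ... | true  = ∑-η-++ (refinements α) true V γ
    ... | false = ∑-scaledCounit-++ γ

  -- The recursion `∑-weighθ-3+` telescopes in steps of two, and a first part of value a contributes
  -- just t^(a-1) to the form given by `difference U`.
  ∑θ-∷∷ : ∀ a b α U → ∑ˡ (θ U) (refinements (a ∷ b ∷ α)) ≈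
    Δ² (p₋ (b ∷ α)) (difference U) (ℕ⁺.predecessor a ℕ.+ slack (b ∷ α))
  ∑θ-∷∷ (1+ a) b α U = trans (∑θ-∷ (1+ a) (b ∷ α) U) (go a)
    where
    V = difference U
    p = p₋ (b ∷ α)
    r = slack (b ∷ α)
    κ = ∑ˡ (scaledCounit (U 0)) (refinements (b ∷ α))
    -- A nonempty composition has no empty refinement.
    κ≈0 : κ ≈ 0#
    κ≈0 = trans (∑-refinements-∷ (scaledCounit (U 0)) b α)
      (∑-compositions-zero (λ _ _ → ∑ˡ-zero (λ _ → refl) (refinements α)) (ℕ⁺.predecessor b))
    closed : ∀ e a → ∑η (b ∷ α) e (λ k → V (a ℕ.+ k)) ≈ Δ² p V (a ℕ.+ r)
    closed e a = trans (∑η-Δ² b α e _) (Δ²-shift p V a r)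
    go : ∀ a → ∑ˡ (weighθ (∑η (b ∷ α)) κ V) (compositions (suc a)) ≈ Δ² p V (a ℕ.+ r)
    go zero          = trans (∑-weighθ-1 (∑η (b ∷ α)) κ V) (closed true 0)
    go (suc zero)    = trans (∑-weighθ-2 (∑η (b ∷ α)) κ V)
      (trans (+-cong (closed true 1) κ≈0) (+-identityʳ _))
    go (suc (suc a)) = begin
      ∑ˡ (weighθ (∑η (b ∷ α)) κ V) (compositions (3 ℕ.+ a))
        ≈⟨ ∑-weighθ-3+ (∑η (b ∷ α)) κ V a ⟩
      (∑η (b ∷ α) true (λ k → V (2 ℕ.+ a ℕ.+ k)) - ∑η (b ∷ α) false (λ k → V (a ℕ.+ k))) +
        ∑ˡ (weighθ (∑η (b ∷ α)) κ V) (compositions (suc a))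
        ≈⟨ +-cong (+-cong (closed true (2 ℕ.+ a)) (-‿cong (closed false a))) (go a) ⟩
      (Δ² p V (2 ℕ.+ a ℕ.+ r) - Δ² p V (a ℕ.+ r)) + Δ² p V (a ℕ.+ r)
        ≈⟨ //-rightDividesˡ _ _ ⟩
      Δ² p V (2 ℕ.+ a ℕ.+ r) ∎

  module Halves (u : Sequence) where

    U : Sequence
    U k = u ℕ.⌊ k /2⌋

    U-suc : ∀ k → isEven k ≡ true → U (suc k) ≡ U k
    U-suc k eq = ≡.cong u (halves k eq)
      where
      halves : ∀ k → isEven k ≡ true → ℕ.⌊ suc k /2⌋ ≡ ℕ.⌊ k /2⌋
      halves zero          eq = ≡.refl
      halves (suc (suc k)) eq = ≡.cong suc (halves k eq)

    V : Sequence
    V = difference U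

    V-even : ∀ k → isEven k ≡ true → V k ≈ 0#
    V-even k eq = trans (+-congʳ (reflexive (U-suc k eq))) (-‿inverseʳ _)

    Δ²-V-even : ∀ p k → isEven k ≡ true → Δ² p V k ≈ 0#
    Δ²-V-even zero    k eq = V-even k eq
    Δ²-V-even (suc p) k eq = trans
      (+-cong (Δ²-V-even p (2 ℕ.+ k) eq) (trans (-‿cong (Δ²-V-even p k eq)) -0#≈0#))
      (+-identityˡ 0#)

    -- Since `U (suc k)` equals `U k` for even `k`, the difference from k + 1 to k + 2 is already
    -- the one from k to k + 2. This is the additional factor t² - 1 behind the summand 1 in `p₊`.
    Δ²-V-odd : ∀ p k → isEven k ≡ true → Δ² p V (suc k) ≈ Δ² (suc p) U k
    Δ²-V-odd zero    k eq = +-congˡ (-‿cong (reflexive (U-suc k eq)))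
    Δ²-V-odd (suc p) k eq = +-cong (Δ²-V-odd p (2 ℕ.+ k) eq) (-‿cong (Δ²-V-odd p k eq))

    -- With no later parts the recursion adds up V (a-1) + V (a-3) + .... For odd a every term is 0;
    -- for even a the sum ends with V 1 + U 0 and telescopes to U a, because U takes equal values at
    -- 2j and 2j + 1.
    ∑θ-[_] : ∀ a → ∑ˡ (θ U) (refinements (a ∷ [])) ≈ (if isEven (value a) then U (value a) else 0#)
    ∑θ-[ 1+ a ] = trans (∑θ-∷ (1+ a) [] U) (go a)
      where
      κ = ∑ˡ (scaledCounit (U 0)) (refinements [])
      closed : ∀ a → ∑η [] true (λ k → V (a ℕ.+ k)) ≈ V a
      closed a = trans (+-identityʳ _) (reflexive (≡.cong V (ℕₚ.+-identityʳ a)))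
      combine : ∀ a → V (2 ℕ.+ a) + (if isEven (suc a) then U (suc a) else 0#) ≈
                      (if isEven (suc a) then U (3 ℕ.+ a) else 0#)
      combine a with isEven (suc a) in eq
      ... | true  = begin
        U (3 ℕ.+ a) - U (2 ℕ.+ a) + U (suc a)
          ≈⟨ +-congˡ (reflexive (U-suc (suc a) eq)) ⟨
        U (3 ℕ.+ a) - U (2 ℕ.+ a) + U (2 ℕ.+ a)
          ≈⟨ //-rightDividesˡ _ _ ⟩
        U (3 ℕ.+ a) ∎
      ... | false = trans (+-identityʳ _) (V-even (2 ℕ.+ a) (isEven-pred a eq))
      go : ∀ a → ∑ˡ (weighθ (∑η []) κ V) (compositions (suc a)) ≈
                 (if isEven (suc a) then U (suc a) else 0#)
      go zero          = trans (∑-weighθ-1 (∑η []) κ V) (trans (closed 0) (V-even 0 ≡.refl))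
      go (suc zero)    = trans (∑-weighθ-2 (∑η []) κ V) (trans
        (+-cong (closed 1) (+-identityʳ _))
        (//-rightDividesˡ _ _))
      go (suc (suc a)) = begin
        ∑ˡ (weighθ (∑η []) κ V) (compositions (3 ℕ.+ a))
          ≈⟨ ∑-weighθ-3+ (∑η []) κ V a ⟩
        (∑η [] true (λ k → V (2 ℕ.+ a ℕ.+ k)) - ∑η [] false (λ k → V (a ℕ.+ k))) +
          ∑ˡ (weighθ (∑η []) κ V) (compositions (suc a))
          ≈⟨ +-cong (+-cong (closed (2 ℕ.+ a)) (trans (-‿cong (+-identityˡ 0#)) -0#≈0#)) (go a) ⟩
        (V (2 ℕ.+ a) + 0#) + (if isEven (suc a) then U (suc a) else 0#)
          ≈⟨ +-congʳ (+-identityʳ _) ⟩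
        V (2 ℕ.+ a) + (if isEven (suc a) then U (suc a) else 0#)
          ≈⟨ combine a ⟩
        (if isEven (suc a) then U (3 ℕ.+ a) else 0#) ∎

-- Functionals on quasi-symmetric functions

flat-parts : ∀ α → flat (parts α) ≡ α
flat-parts []           = ≡.refl
flat-parts ((1+ a) ∷ α) = ≡.cong ((1+ a) ∷_) (flat-parts α)

module Monomials {c ℓ₁ ℓ₂} (𝕜 : HeytingField c ℓ₁ ℓ₂) where

  open HeytingField 𝕜
  open QuasiSymmetric 𝕜

  𝕜-ring : CommutativeRing c ℓ₁
  𝕜-ring = HeytingCommutativeRing.commutativeRing heytingCommutativeRing

  open Deconcatenation 𝕜-ring
  open OddCharacter 𝕜-ring using (ζ^)
  open Refinements 𝕜-ring
  open SetoidReasoning setoid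

  indicator : Composition → Composition → Carrier
  indicator α β = if does (β ≟ᶜ α) then 1# else 0#

  -- Needed because `Δ` ranges over all compositions up to the degree bound; that `compositions`
  -- lists each of them exactly once is what isolates the term of `α`.
  ∑-compositions-indicator : ∀ n α (X : Composition → Carrier) →
    ∑ˡ (λ β → indicator α β * X β) (compositions n) ≈ (if does (n ℕₚ.≟ size α) then X α else 0#)
  ∑-compositions-indicator zero    []                 X = trans (+-identityʳ _) (*-identityˡ _)
  ∑-compositions-indicator zero    (a ∷ α)            X = trans (+-identityʳ _) (zeroˡ _)
  ∑-compositions-indicator (suc n) []                 X = ∑-compositions-zero (λ _ _ → zeroˡ _) n
  ∑-compositions-indicator (suc n) α′@((1+ zero) ∷ α)  X = begin
    ∑ˡ (λ β → indicator α′ β * X β) (compositions (suc n))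
      ≈⟨ ∑-compositions-suc (λ β → indicator α′ β * X β) n ⟩
    ∑ˡ (λ γ → indicator α γ * X ((1+ 0) ∷ γ)) (compositions n) +
      ∑ˡ (enlarged (λ β → indicator α′ β * X β)) (compositions n)
      ≈⟨ +-cong (∑-compositions-indicator n α (X ∘ ((1+ 0) ∷_)))
                (∑ˡ-zero (λ { [] → refl ; ((1+ b) ∷ γ) → zeroˡ _ }) (compositions n)) ⟩
    (if does (n ℕₚ.≟ size α) then X α′ else 0#) + 0#
      ≈⟨ +-identityʳ _ ⟩
    (if does (n ℕₚ.≟ size α) then X α′ else 0#) ∎
  ∑-compositions-indicator (suc n) α′@((1+ suc a) ∷ α) X = begin
    ∑ˡ (λ β → indicator α′ β * X β) (compositions (suc n))
      ≈⟨ ∑-compositions-suc (λ β → indicator α′ β * X β) n ⟩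
    ∑ˡ (λ γ → 0# * X ((1+ 0) ∷ γ)) (compositions n) +
      ∑ˡ (enlarged (λ β → indicator α′ β * X β)) (compositions n)
      ≈⟨ +-cong (∑ˡ-zero (λ _ → zeroˡ _) (compositions n))
                (∑ˡ-cong (λ { [] → sym (zeroˡ _) ; ((1+ b) ∷ γ) → refl }) (compositions n)) ⟩
    0# + ∑ˡ (λ β → indicator ((1+ a) ∷ α) β * enlarged X β) (compositions n)
      ≈⟨ +-identityˡ _ ⟩
    ∑ˡ (λ β → indicator ((1+ a) ∷ α) β * enlarged X β) (compositions n)
      ≈⟨ ∑-compositions-indicator n ((1+ a) ∷ α) (enlarged X) ⟩
    (if does (n ℕₚ.≟ size ((1+ a) ∷ α)) then X α′ else 0#) ∎

  ∑ˡ-applyUpTo : ∀ (f : ℕ → Carrier) (h g : ℕ → ℕ) n →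
                 ∑ˡ f (applyUpTo (h ∘ g) n) ≈ ∑ˡ (f ∘ h) (applyUpTo g n)
  ∑ˡ-applyUpTo f h g zero    = refl
  ∑ˡ-applyUpTo f h g (suc n) = +-congˡ (∑ˡ-applyUpTo f h (g ∘ suc) n)

  ∑-toℕ : ∀ (f : ℕ → Carrier) n → (∑ {n} λ i → f (toℕ i)) ≈ ∑ˡ f (upTo n)
  ∑-toℕ f zero    = refl
  ∑-toℕ f (suc n) = +-congˡ (trans (∑-toℕ (f ∘ suc) n) (sym (∑ˡ-applyUpTo f suc id n)))

  ∑-upTo-last : ∀ N (X : ℕ → Carrier) →
    ∑ˡ (λ n → if does (n ℕₚ.≟ N) then X n else 0#) (upTo (suc N)) ≈ X N
  ∑-upTo-last zero    X = +-identityʳ _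
  ∑-upTo-last (suc N) X = trans (+-identityˡ _) (trans
    (∑ˡ-applyUpTo (λ n → if does (n ℕₚ.≟ suc N) then X n else 0#) suc id (suc N))
    (∑-upTo-last N (X ∘ suc)))

  ∑-deconcatenations : ∀ r s α →
    ∑ˡ (λ i → r (take i α) * s (drop i α)) (upTo (suc (length α))) ≈ (r ⊛ s) α
  ∑-deconcatenations r s []      = +-identityʳ _
  ∑-deconcatenations r s (a ∷ α) = +-congˡ (trans
    (∑ˡ-applyUpTo (λ i → r (take i (a ∷ α)) * s (drop i (a ∷ α))) suc id (suc (length α)))
    (∑-deconcatenations (r ∘ (a ∷_)) s α))

  -- `Δ` puts coefficients into the left tensor factor, hence the scalar in the condition on `ρ`.
  -- The conditions are pointwise so that `bar φ` can serve as `ρ`.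
  ⋆-M : ∀ {ρ ψ r s} → (∀ x β → ρ (x · M β) ≈ x * r β) → (∀ γ → ψ (M γ) ≈ s γ) →
        ∀ α → (ρ ⋆ ψ) (M α) ≈ (r ⊛ s) α
  ⋆-M {ρ} {ψ} {r} {s} p q α = begin
    (ρ ⋆ ψ) (M α)
      ≈⟨ ∑ˡ-concatMap pairing (λ n → concatMap tensors (compositions n)) (upTo (suc (size α))) ⟩
    ∑ˡ (λ n → ∑ˡ pairing (concatMap tensors (compositions n))) (upTo (suc (size α)))
      ≈⟨ ∑ˡ-cong (λ n → ∑ˡ-concatMap pairing tensors (compositions n)) (upTo (suc (size α))) ⟩
    ∑ˡ (λ n → ∑ˡ (λ β → ∑ˡ pairing (tensors β)) (compositions n)) (upTo (suc (size α)))
      ≈⟨ ∑ˡ-cong (λ n → ∑ˡ-cong ∑-tensors (compositions n)) (upTo (suc (size α))) ⟩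
    ∑ˡ (λ n → ∑ˡ (λ β → indicator α β * (r ⊛ s) β) (compositions n)) (upTo (suc (size α)))
      ≈⟨ ∑ˡ-cong (λ n → ∑-compositions-indicator n α (r ⊛ s)) (upTo (suc (size α))) ⟩
    ∑ˡ (λ n → if does (n ℕₚ.≟ size α) then (r ⊛ s) α else 0#) (upTo (suc (size α)))
      ≈⟨ ∑-upTo-last (size α) (λ _ → (r ⊛ s) α) ⟩
    (r ⊛ s) α ∎
    where
    pairing : QSym × QSym → Carrier
    pairing (g , h) = ρ g * ψ h
    tensor : Composition → Composition × Composition → QSym × QSym
    tensor β (γ , γ′) = coeff (M α) (parts β) · M γ , M γ′
    tensors : Composition → Tensors
    tensors β = map (tensor β) (deconcatenations β)
    ∑-tensors : ∀ β → ∑ˡ pairing (tensors β) ≈ indicator α β * (r ⊛ s) β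
    ∑-tensors β = begin
      ∑ˡ pairing (tensors β)
        ≈⟨ ∑ˡ-map pairing (tensor β) (deconcatenations β) ⟩
      ∑ˡ (pairing ∘ tensor β) (deconcatenations β)
        ≈⟨ ∑ˡ-map (pairing ∘ tensor β) (λ i → take i β , drop i β) (upTo (suc (length β))) ⟩
      ∑ˡ (λ i → ρ (coeff (M α) (parts β) · M (take i β)) * ψ (M (drop i β))) (upTo (suc (length β)))
        ≈⟨ ∑ˡ-cong (λ i → trans (*-cong (p _ _) (q _))
             (*-congʳ (*-congʳ (reflexive (≡.cong (indicator α) (flat-parts β)))))) (upTo (suc (length β))) ⟩
      ∑ˡ (λ i → indicator α β * r (take i β) * s (drop i β)) (upTo (suc (length β)))
        ≈⟨ ∑-deconcatenations (λ γ → indicator α β * r γ) s β ⟩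
      ((λ γ → indicator α β * r γ) ⊛ s) β
        ≈⟨ ⊛-*-assoc (indicator α β) r s β ⟩
      indicator α β * (r ⊛ s) β ∎

  if-≟ : ∀ m n {x y z} → (m ≡ n → x ≈ z) → (¬ m ≡ n → y ≈ z) →
         (if does (m ℕₚ.≟ n) then x else y) ≈ z
  if-≟ m n {x} {y} p q = split (m ℕₚ.≟ n)
    where
    split : Dec (m ≡ n) → (if does (m ℕₚ.≟ n) then x else y) ≈ _
    split (yes m≡n) rewrite dec-true (m ℕₚ.≟ n) m≡n = p m≡n
    split (no  m≢n) rewrite dec-false (m ℕₚ.≟ n) m≢n = q m≢n

  -- Here `f` is homogeneous of degree exactly `bound f`, so in the sum defining `bar` only the last
  -- component is nonzero.
  bar-homogeneous : ∀ {φ} → (∀ f g → f ≈ᑫ g → φ f ≈ φ g) → φ 0ᑫ ≈ 0# →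
    ∀ f → (∀ e → ¬ sum e ≡ bound f → coeff f e ≈ 0#) → bar φ f ≈ sgn (bound f) * φ f
  bar-homogeneous {φ} φ-cong φ-0 f homogeneous = begin
    bar φ f
      ≈⟨ ∑-toℕ (λ n → sgn n * φ (component n f)) (suc (bound f)) ⟩
    ∑ˡ (λ n → sgn n * φ (component n f)) (upTo (suc (bound f)))
      ≈⟨ ∑ˡ-cong φ-component (upTo (suc (bound f))) ⟩
    ∑ˡ (λ n → if does (n ℕₚ.≟ bound f) then sgn n * φ f else 0#) (upTo (suc (bound f)))
      ≈⟨ ∑-upTo-last (bound f) (λ n → sgn n * φ f) ⟩
    sgn (bound f) * φ f ∎
    where
    component-top : component (bound f) f ≈ᑫ f
    component-top e = if-≟ (sum e) (bound f) (λ _ → refl) (λ ne → sym (homogeneous e ne))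
    component-other : ∀ {n} → ¬ n ≡ bound f → component n f ≈ᑫ 0ᑫ
    component-other {n} n≢ e = if-≟ (sum e) n (λ { ≡.refl → homogeneous e n≢ }) (λ _ → refl)
    φ-component : ∀ n → sgn n * φ (component n f) ≈
                        (if does (n ℕₚ.≟ bound f) then sgn n * φ f else 0#)
    φ-component n = sym (if-≟ n (bound f)
      (λ { ≡.refl → *-congˡ (sym (φ-cong (component n f) f component-top)) })
      (λ n≢ → sym (trans (*-congˡ (trans (φ-cong (component n f) 0ᑫ (component-other n≢)) φ-0)) (zeroʳ _))))

  M-homogeneous : ∀ α e → ¬ sum e ≡ size α → coeff (M α) e ≈ 0#
  M-homogeneous α e ne with flat e ≟ᶜ α
  ... | yes ≡.refl = contradiction (≡.sym (size-flat e)) ne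
  ... | no  _      = refl

  ζ-M : ∀ α → ζ (M α) ≈ ζ^ α
  ζ-M α = trans (∑-toℕ (λ i → coeff (M α) (i ∷ [])) (suc (size α))) (evaluate α)
    where
    evaluate : ∀ α → ∑ˡ (λ i → coeff (M α) (i ∷ [])) (upTo (suc (size α))) ≈ ζ^ α
    evaluate []            = +-identityʳ _
    evaluate ((1+ a) ∷ []) = trans
      (∑ˡ-cong matches (upTo (suc (size ((1+ a) ∷ [])))))
      (∑-upTo-last (size ((1+ a) ∷ [])) (λ _ → 1#))
      where
      matches : ∀ i → coeff (M ((1+ a) ∷ [])) (i ∷ []) ≈
                      (if does (i ℕₚ.≟ size ((1+ a) ∷ [])) then 1# else 0#)
      matches zero    = refl
      matches (suc i) rewrite ℕₚ.+-identityʳ a | 𝔹.∧-identityʳ (i ℕ.≡ᵇ a) = refl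
    evaluate (a ∷ b ∷ α)   = ∑ˡ-zero fails (upTo (suc (size (a ∷ b ∷ α))))
      where
      fails : ∀ i → coeff (M (a ∷ b ∷ α)) (i ∷ []) ≈ 0#
      fails zero    = refl
      fails (suc i) rewrite 𝔹.∧-zeroʳ (does ((1+ i) ≟⁺ a)) = refl

  ε-M : ∀ α → ε (M α) ≈ counit α
  ε-M []      = refl
  ε-M (_ ∷ _) = refl

  module Character {φ : Functional} (isCharacter : IsCharacter φ) where

    open IsCharacter isCharacter
    open ModuleMorphisms.LeftModuleMorphisms
      QSym-rawLeftModule (TensorUnit.rawLeftModule {R = rawRing})
    open Morphisms.RingMorphisms QSym-rawRing rawRing
    open IsLeftModuleHomomorphism isLeftModuleHomomorphism public
      using () renaming (⟦⟧-cong to φ-cong; +ᴹ-homo to φ-+; 0ᴹ-homo to φ-0; *ₗ-homo to φ-·)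
    open IsRingHomomorphism isRingHomomorphism public
      using () renaming (1#-homo to φ-1)

    φ-F : ∀ α → φ (F α) ≈ ∑ˡ (λ β → φ (M β)) (refinements α)
    φ-F α = φ-∑ (refinements α)
      where
      φ-∑ : ∀ βs → φ (foldr (λ β f → M β +ᑫ f) 0ᑫ βs) ≈ ∑ˡ (λ β → φ (M β)) βs
      φ-∑ []       = φ-0
      φ-∑ (β ∷ βs) = trans (φ-+ (M β) _) (+-congˡ (φ-∑ βs))

    bar-M : ∀ α → bar φ (M α) ≈ sgn (size α) * φ (M α)
    bar-M α = bar-homogeneous (λ f g → φ-cong {f} {g}) φ-0 (M α) (M-homogeneous α)

    bar-·M : ∀ x α → bar φ (x · M α) ≈ x * (sgn (size α) * φ (M α))
    bar-·M x α = trans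
      (bar-homogeneous (λ f g → φ-cong {f} {g}) φ-0 (x · M α)
        (λ e ne → trans (*-congˡ (M-homogeneous α e ne)) (zeroʳ x)))
      (trans (*-congˡ (φ-· x (M α))) (x∙yz≈y∙xz _ _ _))
      where open CommutativeSemigroupProperties (CommutativeRing.*-commutativeSemigroup 𝕜-ring)

-- The two characters

isEven⇒2∣ : ∀ n → isEven n ≡ true → 2 ∣ n
isEven⇒2∣ zero          eq = 2 ∣0
isEven⇒2∣ (suc (suc n)) eq = ∣m∣n⇒∣m+n ∣-refl (isEven⇒2∣ n eq)

2∣⇒isEven : ∀ {n} → 2 ∣ n → isEven n ≡ true
2∣⇒isEven (divides q ≡.refl) = isEven-*2 q
  where
  isEven-*2 : ∀ q → isEven (q ℕ* 2) ≡ true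
  isEven-*2 zero    = ≡.refl
  isEven-*2 (suc q) = isEven-*2 q

2∤⇒¬isEven : ∀ n → 2 ∤ n → isEven n ≡ false
2∤⇒¬isEven n 2∤n with isEven n in eq
... | true  = contradiction (isEven⇒2∣ n eq) 2∤n
... | false = ≡.refl

isEven⇒2*⌊/2⌋ : ∀ n → isEven n ≡ true → 2 ℕ* ⌊ n /2⌋ ≡ n
isEven⇒2*⌊/2⌋ zero          eq = ≡.refl
isEven⇒2*⌊/2⌋ (suc (suc n)) eq =
  ≡.trans (ℕₚ.*-suc 2 ⌊ n /2⌋) (≡.cong (2 ℕ.+_) (isEven⇒2*⌊/2⌋ n eq))

⌊2*m+n/2⌋ : ∀ m n → ⌊ 2 ℕ* m ℕ.+ n /2⌋ ≡ m ℕ.+ ⌊ n /2⌋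
⌊2*m+n/2⌋ zero    n = ≡.refl
⌊2*m+n/2⌋ (suc m) n =
  ≡.trans (≡.cong (λ k → ⌊ k ℕ.+ n /2⌋) (ℕₚ.*-suc 2 m)) (≡.cong suc (⌊2*m+n/2⌋ m n))

isEven-2*m+n : ∀ m n → isEven (2 ℕ* m ℕ.+ n) ≡ isEven n
isEven-2*m+n zero    n = ≡.refl
isEven-2*m+n (suc m) n =
  ≡.trans (≡.cong (λ k → isEven (k ℕ.+ n)) (ℕₚ.*-suc 2 m)) (isEven-2*m+n m n)

-- The central binomials over powers of 4, and the values of the linear form

module NormalisedBinomials {c ℓ₁ ℓ₂} (𝕜 : HeytingField c ℓ₁ ℓ₂)
  (2#0 : HeytingField._#_ 𝕜 (QuasiSymmetric.2# 𝕜) (HeytingField.0# 𝕜)) where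

  open HeytingField 𝕜
  open QuasiSymmetric 𝕜
  open Monomials 𝕜 using (𝕜-ring)
  open CommutativeRing 𝕜-ring
    using (semiring; commutativeSemiring; ring; +-abelianGroup; *-commutativeSemigroup)
  open RingProperties ring using (-0#≈0#; -1*x≈-x)
  open AbelianGroupProperties +-abelianGroup using (xyx⁻¹≈y) renaming (⁻¹-∙-comm to -‿+-comm)
  open CommutativeSemigroupProperties *-commutativeSemigroup
    using () renaming (interchange to *-interchange; x∙yz≈y∙xz to x*yz≈y*xz)
  open Exp semiring using (^-assocʳ)
  open Mult semiring using (×-homo-+; ×1-homo-*)
  open Convolution commutativeSemiring
  open SetoidReasoning setoid

  private
    h = ½ 2#0

  ½*2≈1 : h * 2# ≈ 1#
  ½*2≈1 = trans (*-congˡ (sym (trans (+-congˡ -0#≈0#) (+-identityʳ 2#))))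
    (proj₁ (proj₂ (#⇒invertible 2#0)))

  halve : ∀ {x y} → x + x ≈ y + y → x ≈ y
  halve {x} {y} eq = trans (sym (half x)) (trans (*-congˡ eq) (half y))
    where
    half : ∀ z → h * (z + z) ≈ z
    half z = begin
      h * (z + z)             ≈⟨ *-congˡ (+-cong (*-identityˡ z) (*-identityˡ z)) ⟨
      h * (1# * z + 1# * z)   ≈⟨ *-congˡ (distribʳ z 1# 1#) ⟨
      h * (2# * z)            ≈⟨ *-assoc _ _ _ ⟨
      h * 2# * z              ≈⟨ *-congʳ ½*2≈1 ⟩
      1# * z                  ≈⟨ *-identityˡ z ⟩
      z                       ∎

  ¼ : Carrier
  ¼ = h ^ 2

  ¼*4≈1 : ¼ * fromℕ 4 ≈ 1#
  ¼*4≈1 = begin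
    h * (h * 1#) * fromℕ 4         ≈⟨ *-cong (*-congˡ (*-identityʳ h)) (×1-homo-* 2 2) ⟩
    h * h * (fromℕ 2 * fromℕ 2)    ≈⟨ *-interchange _ _ _ _ ⟩
    h * fromℕ 2 * (h * fromℕ 2)    ≈⟨ *-cong half half ⟩
    1# * 1#                        ≈⟨ *-identityˡ 1# ⟩
    1#                             ∎
    where
    half : h * fromℕ 2 ≈ 1#
    half = trans (*-congˡ (+-congˡ (+-identityʳ 1#))) ½*2≈1

  ¼^m*4^m≈1 : ∀ m → ¼ ^ m * fromℕ (4 ℕ.^ m) ≈ 1#
  ¼^m*4^m≈1 zero    = trans (*-identityˡ _) (+-identityʳ 1#)
  ¼^m*4^m≈1 (suc m) = begin
    ¼ * ¼ ^ m * fromℕ (4 ℕ* 4 ℕ.^ m)             ≈⟨ *-congˡ (×1-homo-* 4 (4 ℕ.^ m)) ⟩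
    ¼ * ¼ ^ m * (fromℕ 4 * fromℕ (4 ℕ.^ m))      ≈⟨ *-interchange _ _ _ _ ⟩
    ¼ * fromℕ 4 * (¼ ^ m * fromℕ (4 ℕ.^ m))      ≈⟨ *-cong ¼*4≈1 (¼^m*4^m≈1 m) ⟩
    1# * 1#                                      ≈⟨ *-identityˡ 1# ⟩
    1#                                           ∎

  fromℕ-conv : ∀ u v m →
    fromℕ (Convolution.conv ℕₚ.+-*-commutativeSemiring u v m) ≈ conv (fromℕ ∘ u) (fromℕ ∘ v) m
  fromℕ-conv u v zero    = ×1-homo-* (u 0) (v 0)
  fromℕ-conv u v (suc m) = trans (×-homo-+ 1# (u 0 ℕ* v (suc m)) _)
    (+-cong (×1-homo-* (u 0) (v (suc m))) (fromℕ-conv (u ∘ suc) v m))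

  -- The substitution t ↦ xt in a product of power series.
  conv-geometric : ∀ x u v m → conv (λ j → x ^ j * u j) (λ j → x ^ j * v j) m ≈ x ^ m * conv u v m
  conv-geometric x u v zero    = trans (*-cong (*-identityˡ _) (*-identityˡ _)) (sym (*-identityˡ _))
  conv-geometric x u v (suc m) = begin
    1# * u 0 * (x ^ suc m * v (suc m)) + conv (λ j → x * x ^ j * u (suc j)) v′ m
      ≈⟨ +-cong (trans (*-congʳ (*-identityˡ _)) (x*yz≈y*xz _ _ _))
                (conv-cong (λ j → *-assoc _ _ _) (λ _ → refl) m) ⟩
    x ^ suc m * (u 0 * v (suc m)) + conv (λ j → x * (x ^ j * u (suc j))) v′ m
      ≈⟨ +-congˡ (trans (conv-*-assoc x (λ j → x ^ j * u (suc j)) v′ m)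
                         (*-congˡ (conv-geometric x (u ∘ suc) v m))) ⟩
    x ^ suc m * (u 0 * v (suc m)) + x * (x ^ m * conv (u ∘ suc) v m)
      ≈⟨ +-congˡ (*-assoc _ _ _) ⟨
    x ^ suc m * (u 0 * v (suc m)) + x ^ suc m * conv (u ∘ suc) v m
      ≈⟨ distribˡ _ _ _ ⟨
    x ^ suc m * conv u v (suc m) ∎
    where v′ = λ j → x ^ j * v j

  -- The coefficients of (1 - x)^(-1/2).
  u : ℕ → Carrier
  u j = ¼ ^ j * fromℕ (C 0 j)

  conv-u : ∀ m → conv u u m ≈ 1#
  conv-u m = begin
    conv u u m                                  ≈⟨ conv-geometric ¼ (fromℕ ∘ C 0) (fromℕ ∘ C 0) m ⟩
    ¼ ^ m * conv (fromℕ ∘ C 0) (fromℕ ∘ C 0) m  ≈⟨ *-congˡ (fromℕ-conv (C 0) (C 0) m) ⟨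
    ¼ ^ m * fromℕ (Convolution.conv ℕₚ.+-*-commutativeSemiring (C 0) (C 0) m)
      ≈⟨ *-congˡ (reflexive (≡.cong fromℕ (CentralBinomial.conv-C m))) ⟩
    ¼ ^ m * fromℕ (4 ℕ.^ m)                     ≈⟨ ¼^m*4^m≈1 m ⟩
    1#                                          ∎

  open OddCharacter 𝕜-ring using (η; θ)
  open Refinements 𝕜-ring
  open Halves u

  U0≈1 : U 0 ≈ 1#
  U0≈1 = trans (*-identityˡ _) (+-identityʳ 1#)

  conv-U : ∀ k → conv U U (suc k) ≈ 1# + 1#
  conv-U k = trans (conv-halves u u k) (+-cong (conv-u ⌊ suc k /2⌋) (conv-u ⌊ k /2⌋))

  -- Divided by a power of 4, `C-pascal` writes the value at `k` as A + B up to sign, with B the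
  -- value at k + 2. The next difference is B - (A + B) = -A, which also produces the alternating
  -- sign.
  Δ²-U : ∀ p k → Δ² p U k ≈ sgn p * (¼ ^ (p ℕ.+ ⌊ k /2⌋) * fromℕ (C p ⌊ k /2⌋))
  Δ²-U zero    k = sym (*-identityˡ _)
  Δ²-U (suc p) k = begin
    Δ² p U (2 ℕ.+ k) - Δ² p U k
      ≈⟨ +-cong (Δ²-U p (2 ℕ.+ k)) (-‿cong (Δ²-U p k)) ⟩
    sgn p * (¼ ^ (p ℕ.+ suc q) * fromℕ (C p (suc q))) - sgn p * (¼ ^ (p ℕ.+ q) * fromℕ (C p q))
      ≈⟨ +-cong (*-congˡ (*-congʳ (reflexive (≡.cong (¼ ^_) (ℕₚ.+-suc p q)))))
                (-‿cong (*-congˡ pascal)) ⟩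
    sgn p * B - sgn p * (A + B)
      ≈⟨ +-congˡ (-‿cong (distribˡ _ _ _)) ⟩
    sgn p * B - (sgn p * A + sgn p * B)
      ≈⟨ +-congˡ (-‿+-comm _ _) ⟨
    sgn p * B + (- (sgn p * A) - sgn p * B)
      ≈⟨ +-assoc _ _ _ ⟨
    sgn p * B - sgn p * A - sgn p * B
      ≈⟨ xyx⁻¹≈y _ _ ⟩
    - (sgn p * A)
      ≈⟨ -1*x≈-x _ ⟨
    - 1# * (sgn p * A)
      ≈⟨ *-assoc _ _ _ ⟨
    sgn (suc p) * A ∎
    where
    q = ⌊ k /2⌋
    A = ¼ ^ suc (p ℕ.+ q) * fromℕ (C (suc p) q)
    B = ¼ ^ suc (p ℕ.+ q) * fromℕ (C p (suc q))
    pascal : ¼ ^ (p ℕ.+ q) * fromℕ (C p q) ≈ A + B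
    pascal = begin
      ¼ ^ (p ℕ.+ q) * fromℕ (C p q)
        ≈⟨ trans (*-congʳ ¼*4≈1) (*-identityˡ _) ⟨
      ¼ * fromℕ 4 * (¼ ^ (p ℕ.+ q) * fromℕ (C p q))
        ≈⟨ *-interchange _ _ _ _ ⟩
      ¼ ^ suc (p ℕ.+ q) * (fromℕ 4 * fromℕ (C p q))
        ≈⟨ *-congˡ (×1-homo-* 4 (C p q)) ⟨
      ¼ ^ suc (p ℕ.+ q) * fromℕ (4 ℕ* C p q)
        ≈⟨ *-congˡ (reflexive (≡.cong fromℕ (SuperCatalan.C-pascal p q))) ⟨
      ¼ ^ suc (p ℕ.+ q) * fromℕ (C (suc p) q ℕ.+ C p (suc q))
        ≈⟨ *-congˡ (×-homo-+ 1# (C (suc p) q) (C p (suc q))) ⟩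
      ¼ ^ suc (p ℕ.+ q) * (fromℕ (C (suc p) q) + fromℕ (C p (suc q)))
        ≈⟨ distribˡ _ _ _ ⟩
      A + B ∎

  -- From n = 2p + k it follows that ⌊n/2⌋ = p + ⌊k/2⌋, so the truncated subtraction is exact.
  Δ²-U-closed : ∀ {n} p k → n ≡ 2 ℕ* p ℕ.+ k →
    Δ² p U k ≈ sgn p * h ^ (2 ℕ* ⌊ n /2⌋) * fromℕ (C p (⌊ n /2⌋ ∸ p))
  Δ²-U-closed {n} p k ≡.refl
    rewrite ⌊2*m+n/2⌋ p k | ℕₚ.m+n∸m≡n p ⌊ k /2⌋ = begin
    Δ² p U k                                                         ≈⟨ Δ²-U p k ⟩
    sgn p * (¼ ^ (p ℕ.+ ⌊ k /2⌋) * fromℕ (C p ⌊ k /2⌋))              ≈⟨ *-assoc _ _ _ ⟨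
    sgn p * ¼ ^ (p ℕ.+ ⌊ k /2⌋) * fromℕ (C p ⌊ k /2⌋)                ≈⟨ *-congʳ (*-congˡ (^-assocʳ h 2 (p ℕ.+ ⌊ k /2⌋))) ⟩
    sgn p * h ^ (2 ℕ* (p ℕ.+ ⌊ k /2⌋)) * fromℕ (C p ⌊ k /2⌋)         ∎

  ∑η-U : ∀ α → ∑ˡ (η true U) (refinements α) ≈ Δ² (p₋ α) U (slack α)
  ∑η-U []      = +-identityʳ _
  ∑η-U (a ∷ α) = ∑η-Δ² a α true U

  ∑θ-U : ∀ α → isEven (size α) ≡ true →
    ∃[ k ] size α ≡ 2 ℕ* p₊ α ℕ.+ k × ∑ˡ (θ U) (refinements α) ≈ Δ² (p₊ α) U k
  ∑θ-U []          eq = 0 , ≡.refl , +-identityʳ _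
  ∑θ-U (a ∷ [])    eq = value a , ℕₚ.+-identityʳ (value a) , trans ∑θ-[ a ]
    (reflexive (≡.cong (λ e → if e then U (value a) else 0#)
      (≡.trans (≡.cong isEven (≡.sym (ℕₚ.+-identityʳ (value a)))) eq)))
  -- As n is even, a + slack is odd and hence positive; taking 1 from it turns n = 2p + 1 + (a +
  -- slack) into 2 (p + 1) + j.
  ∑θ-U ((1+ a) ∷ b ∷ α) eq = odd (a ℕ.+ slack (b ∷ α)) ≡.refl
    where
    p = p₋ (b ∷ α)
    isEven-suc : isEven (suc (a ℕ.+ slack (b ∷ α))) ≡ true
    isEven-suc = ≡.trans (≡.sym (isEven-2*m+n p _))
      (≡.trans (≡.cong isEven (≡.sym (size-∷∷ a b α))) eq)
    odd : ∀ k → k ≡ a ℕ.+ slack (b ∷ α) →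
      ∃[ j ] size ((1+ a) ∷ b ∷ α) ≡ 2 ℕ* suc p ℕ.+ j ×
             ∑ˡ (θ U) (refinements ((1+ a) ∷ b ∷ α)) ≈ Δ² (suc p) U j
    odd zero    k≡ = contradiction (≡.trans (≡.cong (isEven ∘ suc) k≡) isEven-suc) λ ()
    odd (suc j) k≡ = j ,
      ≡.trans (size-∷∷ a b α)
        (≡.trans (≡.cong (λ k → 2 ℕ* p ℕ.+ suc k) (≡.sym k≡)) (shift p j)) ,
      (begin
        ∑ˡ (θ U) (refinements ((1+ a) ∷ b ∷ α)) ≈⟨ ∑θ-∷∷ (1+ a) b α U ⟩
        Δ² p V (a ℕ.+ slack (b ∷ α))            ≈⟨ reflexive (≡.cong (Δ² p V) k≡) ⟨
        Δ² p V (suc j)                          ≈⟨ Δ²-V-odd p j (≡.trans (≡.cong (isEven ∘ suc) k≡) isEven-suc) ⟩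
        Δ² (suc p) U j                          ∎)
      where
      shift : ∀ p j → 2 ℕ* p ℕ.+ suc (suc j) ≡ 2 ℕ* suc p ℕ.+ j
      shift = solve-∀

  ∑θ-U-odd : ∀ α → isEven (size α) ≡ false → ∑ˡ (θ U) (refinements α) ≈ 0#
  ∑θ-U-odd (a ∷ [])    eq = trans ∑θ-[ a ]
    (reflexive (≡.cong (λ e → if e then U (value a) else 0#)
      (≡.trans (≡.cong isEven (≡.sym (ℕₚ.+-identityʳ (value a)))) eq)))
  ∑θ-U-odd ((1+ a) ∷ b ∷ α) eq = trans (∑θ-∷∷ (1+ a) b α U)
    (Δ²-V-even p k (isEven-pred k (≡.trans (≡.sym (isEven-2*m+n p (suc k)))
      (≡.trans (≡.cong isEven (≡.sym (size-∷∷ a b α))) eq))))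
    where
    p = p₋ (b ∷ α)
    k = a ℕ.+ slack (b ∷ α)

theorem5p1 : ∀ {c ℓ₁ ℓ₂} (𝕜 : HeytingField c ℓ₁ ℓ₂) →
    let open HeytingField 𝕜
        open QuasiSymmetric 𝕜 in
    (2#0 : 2# # 0#) →
    (ζ₊ ζ₋ : Functional) → IsParityFactorisation ζ ζ₊ ζ₋ →
    (n : ℕ) (α : Composition) → size α ≡ n →
    (ζ₋ (F α) ≈ sgn (p₋ α) * ½ 2#0 ^ (2 ℕ* ⌊ n /2⌋) * fromℕ (C (p₋ α) (⌊ n /2⌋ ∸ p₋ α)))
    × (2 ∣ n → ζ₊ (F α) ≈ sgn (p₊ α) * ½ 2#0 ^ n * fromℕ (C (p₊ α) (⌊ n /2⌋ ∸ p₊ α)))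
    × (2 ∤ n → ζ₊ (F α) ≈ 0#)
theorem5p1 𝕜 2#0 ζ₊ ζ₋ isParityFactorisation n α ≡.refl =
    (begin
      ζ₋ (F α)                        ≈⟨ χ₋.φ-F α ⟩
      ∑ˡ (λ β → ζ₋ (M β)) (refinements α) ≈⟨ ∑ˡ-cong z₋≗η (refinements α) ⟩
      ∑ˡ (η true U) (refinements α)   ≈⟨ ∑η-U α ⟩
      Δ² (p₋ α) U (slack α)           ≈⟨ Δ²-U-closed (p₋ α) (slack α) (size-slack α) ⟩
      sgn (p₋ α) * ½ 2#0 ^ (2 ℕ* ⌊ n /2⌋) * fromℕ (C (p₋ α) (⌊ n /2⌋ ∸ p₋ α)) ∎)
  , (λ 2∣n → let (k , size≡ , eq) = ∑θ-U α (2∣⇒isEven 2∣n) in begin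
      ζ₊ (F α)                        ≈⟨ ζ₊-F ⟩
      ∑ˡ (θ U) (refinements α)        ≈⟨ eq ⟩
      Δ² (p₊ α) U k                   ≈⟨ Δ²-U-closed (p₊ α) k size≡ ⟩
      sgn (p₊ α) * ½ 2#0 ^ (2 ℕ* ⌊ n /2⌋) * fromℕ (C (p₊ α) (⌊ n /2⌋ ∸ p₊ α))
        ≈⟨ *-congʳ (*-congˡ (reflexive (≡.cong (½ 2#0 ^_) (isEven⇒2*⌊/2⌋ n (2∣⇒isEven 2∣n))))) ⟩
      sgn (p₊ α) * ½ 2#0 ^ n * fromℕ (C (p₊ α) (⌊ n /2⌋ ∸ p₊ α)) ∎)
  , (λ 2∤n → trans ζ₊-F (∑θ-U-odd α (2∤⇒¬isEven n 2∤n)))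
  where
  open HeytingField 𝕜
  open QuasiSymmetric 𝕜
  open IsParityFactorisation isParityFactorisation
  open Monomials 𝕜
  open NormalisedBinomials 𝕜 2#0
  open OddCharacter 𝕜-ring
  open Refinements 𝕜-ring
  open Halves u
  open SetoidReasoning setoid
  module χ₊ = Character isCharacter₊
  module χ₋ = Character isCharacter₋
  -- The remaining arguments restrict evenness, oddness, the unit and the factorisation to the
  -- monomial basis, where `M []` is the unit of the algebra.
  open Factorisation halve {U} U0≈1 conv-U
    {λ α → ζ₊ (M α)} {λ α → ζ₋ (M α)}
    (λ α → trans (sym (χ₊.bar-M α)) (even (M α)))
    (λ α → trans (sym (⋆-M χ₋.bar-·M (λ _ → refl) α)) (trans (proj₁ odd (M α)) (ε-M α)))
    χ₋.φ-1
    (λ α → trans (sym (ζ-M α)) (trans (factorisation (M α))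
      (⋆-M (λ x β → χ₊.φ-· x (M β)) (λ _ → refl) α)))

  ζ₊-F : ζ₊ (F α) ≈ ∑ˡ (θ U) (refinements α)
  ζ₊-F = trans (χ₊.φ-F α) (∑ˡ-cong z₊≗θ (refinements α))
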